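{- Let $p>3$ be a prime. Let $\mathbb{X}_{ -2}(\mathbb{F}_p)=\{(x,y,z)\in\mathbb{F}_p^3 : x^2+y^2+z^2=xyz\}$, let $\mathbb{X}^*_{ -2}(\mathbb{F}_p)=\mathbb{X}_{ -2}(\mathbb{F}_p)\setminus\{(0,0,0)\}$, and let $\mathbb{Y}_{ -2}(\mathbb{F}_p)$ be the set of orbits in $\mathbb{X}^*_{ -2}(\mathbb{F}_p)$ of the Klein four-group $N=\{\mathrm{id},n_1,n_2,n_3\}$, where $n_1(x,y,z)=(x,-y,-z)$, $n_2(x,y,z)=(-x,y,-z)$, $n_3(x,y,z)=(-x,-y,z)$. Let $n=|\mathbb{Y}_{ -2}(\mathbb{F}_p)|$ and let $H(p)$ be the permutation group of $\mathbb{Y}_{ -2}(\mathbb{F}_p)$ induced by the action of $\mathrm{Out}(\mathbf{F}_2)$. Then $H(p)\le A_n$ (i.e. every element of $H(p)$ is an even permutation of $\mathbb{Y}_{ -2}(\mathbb{F}_p)$) if and only if $p\equiv 3\pmod{16}$.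
   Context: $\mathbf{F}_2$ is the free group on two generators; $\mathrm{Out}(\mathbf{F}_2)\cong\mathrm{GL}_2(\mathbf{Z})$ acts on $\mathbb{X}_{ -2}$ by polynomial automorphisms (via Fricke trace coordinates $x=\mathrm{tr}A$, $y=\mathrm{tr}B$, $z=\mathrm{tr}AB$), through $\mathrm{PGL}_2(\mathbf{Z})$, and this action commutes with $N$, so it permutes the $N$-orbits. Concretely, the image of $\mathrm{Out}(\mathbf{F}_2)$ acting on $\mathbb{X}_{ -2}(\mathbb{F}_p)$ is generated by the Markoff moves $m_1(x,y,z)=(yz-x,y,z)$, $m_2(x,y,z)=(x,xz-y,z)$, $m_3(x,y,z)=(x,y,xy-z)$ together with the six permutations of the coordinates; so $H(p)$ is the group of permutations of $\mathbb{Y}_{ -2}(\mathbb{F}_p)$ generated by the permutations induced by $m_1,m_2,m_3$ and the coordinate permutations. $A_n$ denotes the alternating group on the $n$ elements of $\mathbb{Y}_{ -2}(\mathbb{F}_p)$. -}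

module Defs where

open import Data.Nat using (ℕ; zero; suc; _+_; _*_; _∸_; _≡ᵇ_; _<ᵇ_; NonZero)
open import Data.Nat.DivMod using (_%_)
open import Data.Bool using (Bool; true; false; _∧_; _∨_; not; if_then_else_)
open import Data.List using (List; []; _∷_; upTo; filterᵇ; cartesianProduct; length; foldr; map)
open import Data.Product using (_×_; _,_)
open import Function using (_∘_; id)
open import Relation.Binary.PropositionalEquality using (_≡_)

-- Points of F_p^3 are represented by triples (x , y , z) of naturals,
-- each meant to lie in {0, ..., p-1} (the residues mod p).
Triple : Set
Triple = ℕ × ℕ × ℕ

module _ (p : ℕ) .{{_ : NonZero p}} where

  neg : ℕ → ℕ
  neg x = (p ∸ x) % p

  allTriples : List Triple
  allTriples = map (λ { (x , (y , z)) → (x , y , z) })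
                   (cartesianProduct (upTo p) (cartesianProduct (upTo p) (upTo p)))

  onX : Triple → Bool
  onX (x , y , z) = ((x * x + y * y + z * z) % p) ≡ᵇ ((x * y * z) % p)

  nonzeroT : Triple → Bool
  nonzeroT (x , y , z) = not ((x ≡ᵇ 0) ∧ (y ≡ᵇ 0) ∧ (z ≡ᵇ 0))

  n₁ n₂ n₃ : Triple → Triple
  n₁ (x , y , z) = (x , neg y , neg z)
  n₂ (x , y , z) = (neg x , y , neg z)
  n₃ (x , y , z) = (neg x , neg y , z)

  -- lexicographic key of a triple (injective on residue triples)
  key : Triple → ℕ
  key (x , y , z) = x * p * p + y * p + z

  minKey : Triple → Triple → Triple
  minKey s t = if key t <ᵇ key s then t else s

  canon : Triple → Triple
  canon t = minKey (minKey t (n₁ t)) (minKey (n₂ t) (n₃ t))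

  isRep : Triple → Bool
  isRep t = key (canon t) ≡ᵇ key t

  -- Y_{-2}(F_p): the N-orbits in X*_{-2}(F_p), each represented by its
  -- canonical representative; listed in increasing key order.
  Y : List Triple
  Y = filterᵇ (λ t → onX t ∧ nonzeroT t ∧ isRep t) allTriples

  -- generators of the image of Out(F_2): Markoff moves and the six
  -- coordinate permutations
  data Gen : Set where
    m₁ m₂ m₃ : Gen
    σid σ₁₂ σ₁₃ σ₂₃ σ₁₂₃ σ₁₃₂ : Gen

  actGen : Gen → Triple → Triple
  actGen m₁ (x , y , z) = ((y * z + neg x) % p , y , z)
  actGen m₂ (x , y , z) = (x , (x * z + neg y) % p , z)
  actGen m₃ (x , y , z) = (x , y , (x * y + neg z) % p)
  actGen σid  (x , y , z) = (x , y , z)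
  actGen σ₁₂  (x , y , z) = (y , x , z)
  actGen σ₁₃  (x , y , z) = (z , y , x)
  actGen σ₂₃  (x , y , z) = (x , z , y)
  actGen σ₁₂₃ (x , y , z) = (y , z , x)
  actGen σ₁₃₂ (x , y , z) = (z , x , y)

  -- the permutation of Y_{-2}(F_p) induced by a generator
  -- (well defined since the action commutes with N)
  inducedGen : Gen → Triple → Triple
  inducedGen g t = canon (actGen g t)

  -- the permutation of Y induced by a word g₁ g₂ ... gₖ (composite g₁ ∘ ... ∘ gₖ).
  -- Since the generators generate a finite permutation group, the set of
  -- induced maps of all words is exactly the group H(p).
  inducedWord : List Gen → Triple → Triple
  inducedWord = foldr (λ g f → inducedGen g ∘ f) id

  inversions : (Triple → Triple) → ℕ
  inversions f = length (filterᵇ (λ { (a , b) → (key a <ᵇ key b) ∧ (key (f b) <ᵇ key (f a)) })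
                                 (cartesianProduct Y Y))

  HinAlt : Set
  HinAlt = (w : List Gen) → inversions (inducedWord w) % 2 ≡ 0

{-# OPTIONS --safe #-}
-- The sign of a permutation is a homomorphism, and the generators are words in the
-- involutions m₃ and σ₁₂, σ₂₃ (which are conjugate), so only the numbers of 2-cycles of m₃
-- and σ₁₂ modulo 2 matter.  In the coordinates u = 2/x, v = 2/y, w = (2z - xy)/(xy) the
-- surface becomes the sphere u² + v² + w² = 1, N changes the signs of u and v, m₃ is
-- w ↦ -w, and σ₁₂ exchanges u and v.
--
-- Hence the 2-cycles of m₃ are the points of the sphere with uvw ≠ 0 up to all signs, and
-- exchanging u and v shows that their number has the parity of the number of points, up to
-- signs, with uw ≠ 0 on the conic 2u² + w² = 1.
--
-- If -1 is a square, the involution (2u², w²) ↦ (-2u²/w², 1/w²) of this conic has a single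
-- fixed point, so m₃ is odd; and p ≡ 1 mod 4, since multiplication by √-1 acts freely on
-- the nonzero residues up to sign.
--
-- If -1 is not a square, each conic du² + w² = 1 has (p - 3)/4 points with uw ≠ 0 up to
-- signs, by rational parametrisation.  So m₃ is even iff 8 ∣ p - 3.  The sign of σ₁₂ is
-- given by the pairs {u , v} up to signs with u ≠ v and u² + v² = 1 (cancel w against -w);
-- if 8 ∣ p - 3 the number of these is (p - 3)/8, because (p - 3)/4 is even and the circle
-- has at most one point with u = v.
module Submission where

open import Defs
open import Data.Bool.Base using (Bool; T; true; false; _∧_)
open import Data.Bool.Properties using (T-∧; T?)
open import Data.Empty using (⊥; ⊥-elim)
open import Data.List.Base using (List; []; _∷_; _++_; length; filter; foldr; map; upTo; cartesianProduct)
open import Data.List.Properties using (length-++; length-++-sucʳ; length-map; length-upTo)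
open import Data.List.Membership.Propositional using (_∈_; find; lose)
open import Data.List.Membership.Propositional.Properties
open import Data.List.Relation.Unary.AllPairs using ([]; _∷_)
open import Data.List.Relation.Unary.Any using (here; there; any?)
open import Data.List.Relation.Unary.Unique.Propositional using (Unique)
import Data.List.Relation.Unary.Unique.Propositional.Properties as Unique
open import Data.Nat using (ℕ; _<_; NonZero)
open import Data.Nat.Base as ℕ using (zero; suc; z≤n; s≤s; parity)
open import Data.Nat.Coprimality using (prime⇒coprime; coprime-Bézout)
import Data.Nat.Divisibility as ℕ∣
open import Data.Nat.DivMod using (_%_)
import Data.Nat.DivMod as ℕ
open import Data.Nat.GCD using (module Bézout)
open import Data.Nat.Primality using (Prime; euclidsLemma; prime⇒irreducible)
import Data.Nat.Properties as ℕ
open import Data.Nat.Solver using (module +-*-Solver)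
open import Data.Parity.Base as ℙ using (Parity; 0ℙ; 1ℙ)
open import Data.Parity.Properties as ℙ using (+-homo-+)
open import Data.Product using (_×_; _,_; proj₁; proj₂; ∃)
open import Data.Sum.Base as Sum using (_⊎_; inj₁; inj₂; [_,_]′)
open import Data.Unit.Base using (⊤; tt)
open import Function.Base using (_∘_; id; case_of_)
open import Function.Bundles using (_⇔_; mk⇔; module Equivalence)
open import Relation.Binary.Definitions using (tri<; tri≈; tri>; DecidableEquality)
open import Relation.Binary.PropositionalEquality hiding (J)
open import Relation.Nullary using (¬_; Dec; yes; no)
open import Relation.Nullary.Decidable using (¬?; map′; _×-dec_; _⊎-dec_)
open import Relation.Unary using (Decidable)

-- The coordinates come from completing the square in z: four times the surface equation reads (2z -
-- xy)² = x²y² - 4x² - 4y², and division by x²y² gives the sphere. They are undefined where xy = 0.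
-- There m₃ is z ↦ -z, which N undoes, so these orbits are fixed and contribute nothing. For σ₁₂
-- such points have to be ruled out: x = 0 leaves y² + z² = 0, which forces the origin only if -1 is
-- not a square. This is why the sign of σ₁₂ is computed in that case alone. Since u and v are
-- determined only up to sign, they are specified through their squares, and the correspondences
-- between finite sets are relations rather than functions. The modulus 16 records three successive
-- halvings of h = (p - 1)/2: h = 1 + 2c for the c points of a conic up to signs, c = 2b by
-- exchanging the coordinates of the circle, and b even.

module Counting where

  -- Counting finite sets by relations and involutions

  open import Data.Nat.Base using (_+_; _≤_; z≤n; s≤s)
  open import Data.Nat.Properties

  private variable
    A B : Set

  ∈-remove : ∀ {x y : A} (as : List A) {bs} → x ∈ as ++ y ∷ bs → x ≢ y → x ∈ as ++ bs
  ∈-remove as x∈ x≢y with ∈-++⁻ as x∈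
  ... | inj₁ x∈as         = ∈-++⁺ˡ x∈as
  ... | inj₂ (here x≡y)   = ⊥-elim (x≢y x≡y)
  ... | inj₂ (there x∈bs) = ∈-++⁺ʳ as x∈bs

  -- Pigeonhole for a relation: the partner found for the head is deleted from `ys`, and injectivity
  -- keeps the partners of the tail among what remains.
  length-injection : (R : A → B → Set) (xs : List A) (ys : List B) → Unique xs →
    (∀ {x} → x ∈ xs → ∃ λ y → y ∈ ys × R x y) →
    (∀ {x x′ y} → x ∈ xs → x′ ∈ xs → R x y → R x′ y → x ≡ x′) →
    length xs ≤ length ys
  length-injection R [] ys _ _ _ = z≤n
  length-injection R (x ∷ xs) ys u@(_ ∷ u′) tot inj with tot (here refl)
  ... | y , y∈ys , Rxy with ∈-∃++ y∈ys
  ... | as , bs , refl = subst (suc (length xs) ≤_) (sym (length-++-sucʳ as _ _))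
    (s≤s (length-injection R xs (as ++ bs) u′ tot′ (λ p q → inj (there p) (there q))))
    where
    tot′ : ∀ {x′} → x′ ∈ xs → ∃ λ y′ → y′ ∈ as ++ bs × R x′ y′
    tot′ x′∈ with tot (there x′∈)
    ... | y′ , y′∈ , Rx′y′ = y′ , ∈-remove as y′∈ y′≢y , Rx′y′
      where
      y′≢y : y′ ≢ y
      y′≢y refl = Unique.Unique[x∷xs]⇒x∉xs u
        (subst (_∈ xs) (sym (inj (here refl) (there x′∈) Rxy Rx′y′)) x′∈)

  parity-cancel : ∀ l n → parity (l + (l + n)) ≡ parity n
  parity-cancel l n = begin
    parity (l + (l + n))                    ≡⟨ cong parity (+-assoc l l n) ⟨
    parity (l + l + n)                      ≡⟨ +-homo-+ (l + l) n ⟩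
    parity (l + l) ℙ.+ parity n             ≡⟨ cong (ℙ._+ parity n) (+-homo-+ l l) ⟩
    (parity l ℙ.+ parity l) ℙ.+ parity n    ≡⟨ cong (ℙ._+ parity n) (ℙ.p+p≡0ℙ (parity l)) ⟩
    parity n                                ∎
    where open ≡-Reasoning

  record Enum {A : Set} (P : A → Set) : Set where
    constructor enum
    field
      list     : List A
      unique   : Unique list
      sound    : ∀ {x} → x ∈ list → P x
      complete : ∀ {x} → P x → x ∈ list

    card : ℕ
    card = length list

  open Enum public

  module _ {P : A → Set} {Q : B → Set} where

    card-≤ : (E : Enum P) (F : Enum Q) (R : A → B → Set) →
      (∀ {a} → P a → ∃ λ b → Q b × R a b) →
      (∀ {a a′ b} → P a → P a′ → Q b → R a b → R a′ b → a ≡ a′) →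
      card E ≤ card F
    card-≤ E F R tot inj = length-injection (λ a b → Q b × R a b) (list E) (list F) (unique E)
      (λ a∈ → let b , Qb , Rab = tot (sound E a∈) in b , complete F Qb , Qb , Rab)
      (λ a∈ a′∈ (Qb , Rab) (_ , Ra′b) → inj (sound E a∈) (sound E a′∈) Qb Rab Ra′b)

  module _ {P : A → Set} {Q : B → Set} where

    card-≡ : (E : Enum P) (F : Enum Q) (R : A → B → Set) →
      (∀ {a} → P a → ∃ λ b → Q b × R a b) →
      (∀ {b} → Q b → ∃ λ a → P a × R a b) →
      (∀ {a a′ b} → P a → P a′ → Q b → R a b → R a′ b → a ≡ a′) →
      (∀ {a b b′} → P a → Q b → Q b′ → R a b → R a b′ → b ≡ b′) →
      card E ≡ card F
    card-≡ E F R totˡ totʳ injˡ injʳ = ≤-antisym (card-≤ E F R totˡ injˡ)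
      (card-≤ F E (λ b a → R a b) totʳ (λ Qb Qb′ Pa → injʳ Pa Qb Qb′))

  card-cong : {P Q : A → Set} (E : Enum P) (F : Enum Q) →
    (∀ {a} → P a → Q a) → (∀ {a} → Q a → P a) → card E ≡ card F
  card-cong E F P⊆Q Q⊆P = card-≡ E F _≡_ (λ Pa → _ , P⊆Q Pa , refl) (λ Qa → _ , Q⊆P Qa , refl)
    (λ { _ _ _ refl refl → refl }) (λ { _ _ _ refl refl → refl })

  card-⊎ : {P Q R : A → Set} (E : Enum P) (F : Enum Q) (G : Enum R) →
    (∀ {a} → P a → Q a ⊎ R a) → (∀ {a} → Q a → P a) → (∀ {a} → R a → P a) →
    (∀ {a} → Q a → R a → ⊥) → card E ≡ card F + card G
  card-⊎ E F G P⊆ Q⊆ R⊆ dis = trans (card-cong E F++G P⊆ λ { (inj₁ q) → Q⊆ q ; (inj₂ r) → R⊆ r })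
                                     (length-++ (list F))
    where
    F++G : Enum _
    F++G = enum (list F ++ list G)
      (Unique.++⁺ (unique F) (unique G) λ (i , j) → dis (sound F i) (sound G j))
      (λ i → case ∈-++⁻ (list F) i of λ { (inj₁ j) → inj₁ (sound F j) ; (inj₂ j) → inj₂ (sound G j) })
      (λ { (inj₁ q) → ∈-++⁺ˡ (complete F q) ; (inj₂ r) → ∈-++⁺ʳ (list F) (complete G r) })

  infixl 5 _∩_
  _∩_ : {P Q : A → Set} → Enum P → Decidable Q → Enum (λ a → P a × Q a)
  E ∩ Q? = enum (filter Q? (list E)) (Unique.filter⁺ Q? (unique E))
    (λ i → let j , q = ∈-filter⁻ Q? {xs = list E} i in sound E j , q)
    (λ (p , q) → ∈-filter⁺ Q? (complete E p) q)

  infixr 6 _⊗_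
  _⊗_ : {P : A → Set} {Q : B → Set} → Enum P → Enum Q → Enum (λ (a , b) → P a × Q b)
  E ⊗ F = enum (cartesianProduct (list E) (list F)) (Unique.cartesianProduct⁺ (unique E) (unique F))
    (λ i → let j , k = ∈-cartesianProduct⁻ (list E) (list F) i in sound E j , sound F k)
    (λ (p , q) → ∈-cartesianProduct⁺ (complete E p) (complete F q))

  below : ∀ n → Enum (_< n)
  below n = enum (upTo n) (Unique.upTo⁺ n) ∈-upTo⁻ ∈-upTo⁺

  from1to : ∀ n → Enum (λ x → 0 < x × x ≤ n)
  from1to n = enum (map suc (upTo n)) (Unique.map⁺ suc-injective (Unique.upTo⁺ n))
    (λ i → case ∈-map⁻ suc i of λ { (_ , j , refl) → s≤s z≤n , ∈-upTo⁻ j })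
    (λ { (s≤s _ , x≤n) → ∈-map⁺ suc (∈-upTo⁺ x≤n) })

  card-from1to : ∀ n → card (from1to n) ≡ n
  card-from1to n = trans (length-map suc (upTo n)) (length-upTo n)

  -- If `b` were missed, `f` would inject the list into the shorter list with `b` deleted.
  injective⇒surjective : {P : A → Set} → DecidableEquality A → Enum P → (f : A → A) →
    (∀ {a} → P a → P (f a)) → (∀ {a b} → P a → P b → f a ≡ f b → a ≡ b) →
    ∀ {b} → P b → ∃ λ a → P a × f a ≡ b
  injective⇒surjective {A} _≟A_ E f maps inj {b} Pb with any? (λ a → f a ≟A b) (list E)
  ... | yes i = let a , a∈ , eq = find i in a , sound E a∈ , eq
  ... | no ¬i with ∈-∃++ (complete E Pb)
  ... | as , bs , eq = ⊥-elim (<-irrefl refl (≤-trans (≤-reflexive (sym len)) short))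
    where
    short : length (list E) ≤ length (as ++ bs)
    short = length-injection (λ x y → f x ≡ y) (list E) (as ++ bs) (unique E)
      (λ {x} x∈ → f x , ∈-remove as (subst (f x ∈_) eq (complete E (maps (sound E x∈))))
                         (λ fx≡b → ¬i (lose x∈ fx≡b)) , refl)
      (λ i j p q → inj (sound E i) (sound E j) (trans p (sym q)))
    len : length (list E) ≡ suc (length (as ++ bs))
    len = trans (cong length eq) (length-++-sucʳ as _ _)

  -- The label `k` selects a member of each 2-cycle by comparison. It need not be injective, only
  -- separate `a` from `f a` unless they agree, so a single coordinate can serve.
  module Involution {P : A → Set} (f : A → A) (k : A → ℕ)
    (maps : ∀ {a} → P a → P (f a)) (invol : ∀ {a} → P a → f (f a) ≡ a)
    (k-fix : ∀ {a} → P a → k (f a) ≡ k a → f a ≡ a)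
    where

    -- One element of each 2-cycle of f.
    Ascent : A → Set
    Ascent a = P a × k a < k (f a)

    Fixed : A → Set
    Fixed a = P a × f a ≡ a

    ascents : Enum P → Enum Ascent
    ascents E = E ∩ (λ a → k a <? k (f a))

    fixedPoints : Enum P → Enum Fixed
    fixedPoints E = enum (list F) (unique F) (λ i → let p , q = sound F i in p , k-fix p q)
                         (λ (p , q) → complete F (p , cong k q))
      where F = E ∩ (λ a → k (f a) ≟ k a)

    -- `f` exchanges the elements whose label it raises with those whose label it lowers.
    count : (E : Enum P) (L : Enum Ascent) (F : Enum Fixed) → card E ≡ card L + (card L + card F)
    count E L F = trans
      (card-⊎ E L N (λ {a} p → case k a <? k (f a) of λ { (yes q) → inj₁ (p , q) ; (no q) → inj₂ (p , q) })
         proj₁ proj₁ (λ (_ , q) (_ , r) → r q))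
      (cong (card L +_) (trans (card-⊎ N D F split (λ (p , q) → p , <-asym q)
         (λ (p , q) → p , λ r → <-irrefl (cong k (sym q)) r) (λ (_ , q) (_ , r) → <-irrefl (cong k r) q))
         (cong (_+ card F) D≡L)))
      where
      N = E ∩ (λ a → ¬? (k a <? k (f a)))
      D = E ∩ (λ a → k (f a) <? k a)
      split : ∀ {a} → P a × ¬ k a < k (f a) → (P a × k (f a) < k a) ⊎ Fixed a
      split {a} (p , q) with <-cmp (k a) (k (f a))
      ... | tri< r _ _ = ⊥-elim (q r)
      ... | tri≈ _ r _ = inj₂ (p , k-fix p (sym r))
      ... | tri> _ _ r = inj₁ (p , r)
      D≡L : card D ≡ card L
      D≡L = card-≡ D L (λ a b → f a ≡ b)
        (λ {a} (p , q) → f a , (maps p , subst (k (f a) <_) (cong k (sym (invol p))) q) , refl)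
        (λ {b} (p , q) → f b , (maps p , subst (_< k (f b)) (cong k (sym (invol p))) q) , invol p)
        (λ (p , _) (p′ , _) _ r s → trans (sym (invol p)) (trans (cong f (trans r (sym s))) (invol p′)))
        (λ _ _ _ r s → trans (sym r) s)

    parity-card : (E : Enum P) (F : Enum Fixed) → parity (card E) ≡ parity (card F)
    parity-card E F = trans (cong parity (count E (ascents E) F)) (parity-cancel (card (ascents E)) (card F))

    -- Allows `R` to be stated on all of `P`, without reference to the chosen member of a 2-cycle:
    -- `R` is invariant under `f`, and its fibre over each `b` is a single 2-cycle.
    card-ascents : {Q : B → Set} (L : Enum Ascent) (F : Enum Q) (R : A → B → Set) →
      (∀ {a b} → P a → Q b → R a b → R (f a) b) →
      (∀ {a} → P a → f a ≢ a → ∃ λ b → Q b × R a b) →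
      (∀ {b} → Q b → ∃ λ a → P a × f a ≢ a × R a b) →
      (∀ {a a′ b} → P a → P a′ → Q b → R a b → R a′ b → a′ ≡ a ⊎ a′ ≡ f a) →
      (∀ {a b b′} → P a → Q b → Q b′ → R a b → R a b′ → b ≡ b′) →
      card L ≡ card F
    card-ascents {Q = Q} L F R R-f totˡ totʳ injˡ injʳ = card-≡ L F R
      (λ (p , q) → totˡ p λ r → <-irrefl (cong k (sym r)) q)
      totʳ′ injˡ′ (λ (p , _) → injʳ p)
      where
      totʳ′ : ∀ {b} → Q b → ∃ λ a → Ascent a × R a b
      totʳ′ Qb with totʳ Qb
      ... | a , Pa , fa≢a , Rab with <-cmp (k a) (k (f a))
      ... | tri< r _ _ = a , (Pa , r) , Rab
      ... | tri≈ _ r _ = ⊥-elim (fa≢a (k-fix Pa (sym r)))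
      ... | tri> _ _ r = f a , (maps Pa , subst (k (f a) <_) (cong k (sym (invol Pa))) r) , R-f Pa Qb Rab
      injˡ′ : ∀ {a a′ b} → Ascent a → Ascent a′ → Q b → R a b → R a′ b → a ≡ a′
      injˡ′ {a} (p , q) (p′ , q′) Qb Rab Ra′b with injˡ p p′ Qb Rab Ra′b
      ... | inj₁ r    = sym r
      ... | inj₂ refl = ⊥-elim (<-asym q (subst (k (f a) <_) (cong k (invol p)) q′))

  card-singleton : {A : Set} {P : A → Set} (E : Enum P) →
    ∃ P → (∀ {a b} → P a → P b → a ≡ b) → card E ≡ 1
  card-singleton E (a , Pa) unq = card-≡ E (below 1) (λ _ _ → ⊤)
    (λ _ → 0 , s≤s z≤n , tt) (λ _ → a , Pa , tt) (λ p q _ _ _ → unq p q)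
    (λ { _ (s≤s z≤n) (s≤s z≤n) _ _ → refl })

  card-≤1 : {A : Set} {P : A → Set} (E : Enum P) → (∀ {a b} → P a → P b → a ≡ b) → card E ≤ 1
  card-≤1 E unq = card-≤ E (below 1) (λ _ _ → ⊤) (λ _ → 0 , s≤s z≤n , tt) (λ p q _ _ _ → unq p q)

  card-empty : {A : Set} {P : A → Set} (E : Enum P) → (∀ {a} → ¬ P a) → card E ≡ 0
  card-empty E none = card-cong E (enum [] [] (λ ()) (λ p → ⊥-elim (none p))) (⊥-elim ∘ none) λ p → p

  -- The sign of a permutation by counting inversions

  module Inversions {A : Set} {P : A → Set} (E : Enum P) (k : A → ℕ)
    (k-injective : ∀ {a b} → P a → P b → k a ≡ k b → a ≡ b)
    where

    Inversion : (A → A) → A × A → Set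
    Inversion f (a , b) = (P a × P b) × (k a < k b × k (f b) < k (f a))

    inversionEnum : ∀ f → Enum (Inversion f)
    inversionEnum f = E ⊗ E ∩ (λ (a , b) → (k a <? k b) ×-dec (k (f b) <? k (f a)))

    sgn : (A → A) → Parity
    sgn f = parity (card (inversionEnum f))

    record IsPermutation (f : A → A) : Set where
      field
        inverse  : A → A
        maps     : ∀ {a} → P a → P (f a)
        maps⁻¹   : ∀ {a} → P a → P (inverse a)
        inverseˡ : ∀ {a} → P a → inverse (f a) ≡ a
        inverseʳ : ∀ {a} → P a → f (inverse a) ≡ a

      injective : ∀ {a b} → P a → P b → f a ≡ f b → a ≡ b
      injective p q e = trans (sym (inverseˡ p)) (trans (cong inverse e) (inverseˡ q))

    open IsPermutation

    id-permutation : IsPermutation (λ a → a)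
    id-permutation = record
      { inverse = λ a → a ; maps = λ p → p ; maps⁻¹ = λ p → p ; inverseˡ = λ _ → refl ; inverseʳ = λ _ → refl }

    ∘-permutation : ∀ {f g} → IsPermutation f → IsPermutation g → IsPermutation (f ∘ g)
    ∘-permutation {f} F G = record
      { inverse  = inverse G ∘ inverse F
      ; maps     = maps F ∘ maps G
      ; maps⁻¹   = maps⁻¹ G ∘ maps⁻¹ F
      ; inverseˡ = λ p → trans (cong (inverse G) (inverseˡ F (maps G p))) (inverseˡ G p)
      ; inverseʳ = λ p → trans (cong f (inverseʳ G (maps⁻¹ F p))) (inverseʳ F p)
      }

    sgn-cong : ∀ {f g} → (∀ {a} → P a → f a ≡ g a) → sgn f ≡ sgn g
    sgn-cong {f} {g} f≡g = cong parity (card-cong (inversionEnum f) (inversionEnum g)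
      (λ { {a , b} ((p , q) , r , s) → (p , q) , r , subst₂ _<_ (cong k (f≡g q)) (cong k (f≡g p)) s })
      (λ { {a , b} ((p , q) , r , s) → (p , q) , r , subst₂ _<_ (cong k (sym (f≡g q))) (cong k (sym (f≡g p))) s }))

    k-tri : ∀ {a b} → P a → P b → a ≢ b → ¬ k a < k b → k b < k a
    k-tri {a} {b} p q a≢b ¬< with <-cmp (k a) (k b)
    ... | tri< r _ _ = ⊥-elim (¬< r)
    ... | tri≈ _ r _ = ⊥-elim (a≢b (k-injective p q r))
    ... | tri> _ _ r = r

    module _ {f g : A → A} (F : IsPermutation f) (G : IsPermutation g) where

      -- For a < b, {a , b} is an inversion of f ∘ g iff exactly one of the following
      -- holds: {a , b} is an inversion of g; {g a , g b} is an inversion of f.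
      private
        Ig If : A × A → Set
        Ig (a , b) = k (g b) < k (g a)
        If (a , b) = k (f (g b)) < k (f (g a))

        Ordered Xor : A × A → Set
        Ordered (a , b) = (P a × P b) × k a < k b
        Xor ab = (If ab × ¬ Ig ab) ⊎ (Ig ab × ¬ If ab)

        Ig? : ∀ ab → Dec (Ig ab)
        Ig? (a , b) = k (g b) <? k (g a)
        If? : ∀ ab → Dec (If ab)
        If? (a , b) = k (f (g b)) <? k (f (g a))

        O : Enum Ordered
        O = E ⊗ E ∩ (λ (a , b) → k a <? k b)

        eBoth = O ∩ λ ab → If? ab ×-dec Ig? ab
        eIf = O ∩ λ ab → If? ab ×-dec ¬? (Ig? ab)
        eIg = O ∩ λ ab → Ig? ab ×-dec ¬? (If? ab)
        eXor = O ∩ λ ab → (If? ab ×-dec ¬? (Ig? ab)) ⊎-dec (Ig? ab ×-dec ¬? (If? ab))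

        card-f∘g : card (inversionEnum (f ∘ g)) ≡ card eBoth + card eIf
        card-f∘g = card-⊎ (inversionEnum (f ∘ g)) eBoth eIf
          (λ { {ab} (p , q , r) → case Ig? ab of λ { (yes s) → inj₁ ((p , q) , r , s) ; (no s) → inj₂ ((p , q) , r , s) } })
          (λ ((p , q) , r , _) → p , q , r) (λ ((p , q) , r , _) → p , q , r)
          (λ (_ , _ , r) (_ , _ , s) → s r)

        card-g : card (inversionEnum g) ≡ card eBoth + card eIg
        card-g = card-⊎ (inversionEnum g) eBoth eIg
          (λ { {ab} (p , q , r) → case If? ab of λ { (yes s) → inj₁ ((p , q) , s , r) ; (no s) → inj₂ ((p , q) , r , s) } })
          (λ ((p , q) , _ , r) → p , q , r) (λ ((p , q) , r , _) → p , q , r)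
          (λ (_ , r , _) (_ , _ , s) → s r)

        card-xor : card eXor ≡ card eIf + card eIg
        card-xor = card-⊎ eXor eIf eIg
          (λ { (p , inj₁ q) → inj₁ (p , q) ; (p , inj₂ q) → inj₂ (p , q) })
          (λ (p , q) → p , inj₁ q) (λ (p , q) → p , inj₂ q)
          (λ (_ , _ , q) (_ , r , _) → q r)

        SamePair : A × A → A × A → Set
        SamePair (a , b) (c , d) = (g a ≡ c × g b ≡ d) ⊎ (g a ≡ d × g b ≡ c)

        -- The bijection is `g` on unordered pairs. Listing the image pair in increasing order
        -- exchanges its entries exactly when `g` inverts the pair, whence the two disjuncts of
        -- `SamePair`.
        card-f : card eXor ≡ card (inversionEnum f)
        card-f = card-≡ eXor (inversionEnum f) SamePair totˡ totʳ injˡ injʳ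
          where
          totˡ : ∀ {ab} → Ordered ab × Xor ab → ∃ λ cd → Inversion f cd × SamePair ab cd
          totˡ {a , b} (((p , q) , r) , inj₁ (s , t)) =
            (g a , g b) , ((maps G p , maps G q) ,
              k-tri (maps G q) (maps G p) (λ e → <-irrefl (cong k (injective G p q (sym e))) r) t , s) ,
            inj₁ (refl , refl)
          totˡ {a , b} (((p , q) , r) , inj₂ (s , t)) =
            (g b , g a) , ((maps G q , maps G p) , s ,
              k-tri (maps F (maps G q)) (maps F (maps G p))
                (λ e → <-irrefl (cong k (injective G p q (sym (injective F (maps G q) (maps G p) e)))) r) t) ,
            inj₂ (refl , refl)

          totʳ : ∀ {cd} → Inversion f cd → ∃ λ ab → (Ordered ab × Xor ab) × SamePair ab cd
          totʳ {c , d} ((p , q) , r , s) with <-cmp (k (inverse G c)) (k (inverse G d))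
          ... | tri< t _ _ = (inverse G c , inverse G d) ,
            (((maps⁻¹ G p , maps⁻¹ G q) , t) ,
              inj₁ (subst₂ (λ x y → k (f y) < k (f x)) (sym (inverseʳ G p)) (sym (inverseʳ G q)) s ,
                    subst₂ (λ x y → ¬ k y < k x) (sym (inverseʳ G p)) (sym (inverseʳ G q)) (<-asym r))) ,
            inj₁ (inverseʳ G p , inverseʳ G q)
          ... | tri≈ _ t _ = ⊥-elim (<-irrefl (cong k (trans (sym (inverseʳ G p))
                               (trans (cong g (k-injective (maps⁻¹ G p) (maps⁻¹ G q) t)) (inverseʳ G q)))) r)
          ... | tri> _ _ t = (inverse G d , inverse G c) ,
            (((maps⁻¹ G q , maps⁻¹ G p) , t) ,
              inj₂ (subst₂ (λ x y → k x < k y) (sym (inverseʳ G p)) (sym (inverseʳ G q)) r ,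
                    subst₂ (λ x y → ¬ k (f x) < k (f y)) (sym (inverseʳ G p)) (sym (inverseʳ G q)) (<-asym s))) ,
            inj₂ (inverseʳ G q , inverseʳ G p)

          injˡ : ∀ {ab ab′ cd} → Ordered ab × Xor ab → Ordered ab′ × Xor ab′ → Inversion f cd →
                 SamePair ab cd → SamePair ab′ cd → ab ≡ ab′
          injˡ (((p , q) , r) , _) (((p′ , q′) , r′) , _) _ (inj₁ (s , t)) (inj₁ (s′ , t′)) =
            cong₂ _,_ (injective G p p′ (trans s (sym s′))) (injective G q q′ (trans t (sym t′)))
          injˡ (((p , q) , r) , _) (((p′ , q′) , r′) , _) _ (inj₂ (s , t)) (inj₂ (s′ , t′)) =
            cong₂ _,_ (injective G p p′ (trans s (sym s′))) (injective G q q′ (trans t (sym t′)))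
          injˡ (((p , q) , r) , _) (((p′ , q′) , r′) , _) _ (inj₁ (s , t)) (inj₂ (s′ , t′)) =
            ⊥-elim (<-asym r (subst₂ (λ x y → k x < k y) (injective G p′ q (trans s′ (sym t)))
                                                           (injective G q′ p (trans t′ (sym s))) r′))
          injˡ (((p , q) , r) , _) (((p′ , q′) , r′) , _) _ (inj₂ (s , t)) (inj₁ (s′ , t′)) =
            ⊥-elim (<-asym r (subst₂ (λ x y → k x < k y) (injective G p′ q (trans s′ (sym t)))
                                                           (injective G q′ p (trans t′ (sym s))) r′))

          injʳ : ∀ {ab cd cd′} → Ordered ab × Xor ab → Inversion f cd → Inversion f cd′ →
                 SamePair ab cd → SamePair ab cd′ → cd ≡ cd′
          injʳ _ _ _ (inj₁ (refl , refl)) (inj₁ (refl , refl)) = refl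
          injʳ _ _ _ (inj₂ (refl , refl)) (inj₂ (refl , refl)) = refl
          injʳ _ (_ , r , _) (_ , s , _) (inj₁ (refl , refl)) (inj₂ (refl , refl)) = ⊥-elim (<-asym r s)
          injʳ _ (_ , r , _) (_ , s , _) (inj₂ (refl , refl)) (inj₁ (refl , refl)) = ⊥-elim (<-asym r s)

      sgn-∘ : sgn (f ∘ g) ≡ sgn f ℙ.+ sgn g
      sgn-∘ = begin
        parity (card (inversionEnum (f ∘ g)))             ≡⟨ cong parity card-f∘g ⟩
        -- Adding `y` twice keeps the parity and completes both counts: x + y inversions of `f` and
        -- b + y of `g`.
        parity (b + x)                                    ≡⟨ parity-cancel y (b + x) ⟨
        parity (y + (y + (b + x)))                        ≡⟨ cong parity (solve 3 (λ b x y → y :+ (y :+ (b :+ x)) := (x :+ y) :+ (b :+ y)) refl b x y) ⟩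
        parity ((x + y) + (b + y))                        ≡⟨ +-homo-+ (x + y) (b + y) ⟩
        parity (x + y) ℙ.+ parity (b + y)                 ≡⟨ cong₂ (λ m n → parity m ℙ.+ parity n) (trans (sym card-xor) card-f) (sym card-g) ⟩
        sgn f ℙ.+ sgn g                                   ∎
        where
        open ≡-Reasoning
        open +-*-Solver
        b = card eBoth
        x = card eIf
        y = card eIg

    -- The identity is its own square, so its sign s satisfies s = s + s = 0.
    sgn-id : sgn (λ a → a) ≡ 0ℙ
    sgn-id = trans (sgn-∘ id-permutation id-permutation) (ℙ.p+p≡0ℙ (sgn (λ a → a)))

    module _ (f : A → A) (maps : ∀ {a} → P a → P (f a)) (invol : ∀ {a} → P a → f (f a) ≡ a) where

      open Involution f k maps invol (λ p → k-injective (maps p) p) using (Ascent)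

      -- (a , b) ↦ (f b , f a) is an involution of the inversions, fixing exactly the
      -- pairs (a , f a) with a < f a.
      sgn-involution : (L : Enum Ascent) → sgn f ≡ parity (card L)
      sgn-involution L = trans (Swap.parity-card inv fixed) (cong parity fixed≡L)
        where
        inv = inversionEnum f

        swap : A × A → A × A
        swap (a , b) = f b , f a

        swap-fix : ∀ {ab} → Inversion f ab → k (f (proj₂ ab)) ≡ k (proj₁ ab) → swap ab ≡ ab
        swap-fix {a , b} ((p , q) , _) e =
          let fb≡a = k-injective (maps q) p e
          in cong₂ _,_ fb≡a (trans (cong f (sym fb≡a)) (invol q))

        swap-maps : ∀ {ab} → Inversion f ab → Inversion f (swap ab)
        swap-maps {a , b} ((p , q) , r , s) =
          (maps q , maps p) , s , subst₂ (λ x y → k x < k y) (sym (invol p)) (sym (invol q)) r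

        swap-invol : ∀ {ab} → Inversion f ab → swap (swap ab) ≡ ab
        swap-invol {a , b} ((p , q) , _) = cong₂ _,_ (invol p) (invol q)

        module Swap = Involution {P = Inversion f} swap (k ∘ proj₁)
          swap-maps swap-invol swap-fix

        fixed = Swap.fixedPoints inv

        fixed≡L : card fixed ≡ card L
        fixed≡L = card-≡ fixed L (λ ab c → proj₁ ab ≡ c)
          (λ { {a , b} (((p , q) , r , _) , s) → a , (p , subst (k a <_) (cong k (sym (cong proj₂ s))) r) , refl })
          (λ { {c} (p , r) → (c , f c) , (((p , maps p) , r , subst (_< k (f c)) (cong k (sym (invol p))) r) ,
                                cong (_, f c) (invol p)) , refl })
          (λ { {a , b} {a′ , b′} (_ , s) (_ , s′) _ refl refl →
               cong (a ,_) (trans (sym (cong proj₂ s)) (cong proj₂ s′)) })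
          (λ _ _ _ r s → trans (sym r) s)

open Counting

-- Parities, and p modulo 16 in terms of h

parity⇒%2 : ∀ n → parity n ≡ 0ℙ → n ℕ.% 2 ≡ 0
parity⇒%2 zero          _ = refl
parity⇒%2 (suc (suc n)) e = parity⇒%2 n e

%2⇒parity : ∀ n → n ℕ.% 2 ≡ 0 → parity n ≡ 0ℙ
%2⇒parity zero          _ = refl
%2⇒parity (suc (suc n)) e = %2⇒parity n e

parity-even : ∀ n → parity n ≡ 0ℙ → ∃ λ k → n ≡ k ℕ.+ k
parity-even zero          _ = 0 , refl
parity-even (suc (suc n)) e = let k , eq = parity-even n e in
  suc k , cong suc (trans (cong suc eq) (sym (ℕ.+-suc k k)))

parity-double : ∀ k → parity (k ℕ.+ k) ≡ 0ℙ
parity-double k = trans (+-homo-+ k k) (ℙ.p+p≡0ℙ (parity k))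

parity-suc-double : ∀ k → parity (suc (k ℕ.+ k)) ≡ 1ℙ
parity-suc-double k = trans (+-homo-+ 1 (k ℕ.+ k)) (cong (1ℙ ℙ.+_) (parity-double k))

n*2≡n+n : ∀ n → n ℕ.* 2 ≡ n ℕ.+ n
n*2≡n+n n = trans (ℕ.*-comm n 2) (cong (n ℕ.+_) (ℕ.+-identityʳ n))

double-injective : ∀ m n → m ℕ.+ m ≡ n ℕ.+ n → m ≡ n
double-injective m n e = ℕ.*-cancelʳ-≡ m n 2 (trans (n*2≡n+n m) (trans e (sym (n*2≡n+n n))))

odd-prime : ∀ p → Prime p → 2 ℕ.< p → p ≡ suc (p ℕ./ 2 ℕ.+ p ℕ./ 2)
odd-prime p pr 2<p with p ℕ.% 2 in eq | ℕ.m%n<n p 2 | ℕ.m≡m%n+[m/n]*n p 2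
... | 0 | _ | _ = ⊥-elim ([ (λ ()) , (λ 2≡p → ℕ.<-irrefl 2≡p 2<p) ]′ (prime⇒irreducible pr (ℕ∣.m%n≡0⇒n∣m p 2 eq)))
... | 1 | _ | e = trans e (cong suc (n*2≡n+n (p ℕ./ 2)))
... | suc (suc _) | s≤s (s≤s ()) | _

module _ (p h : ℕ) (p≡2h+1 : p ≡ suc (h ℕ.+ h)) where

  private
    module N = +-*-Solver
    quadruple : ℕ → ℕ
    quadruple q = (q ℕ.+ q) ℕ.+ (q ℕ.+ q)
    p≡3+16q : ∀ q → suc (suc (quadruple q ℕ.+ quadruple q) ℕ.+ suc (quadruple q ℕ.+ quadruple q)) ≡ 3 ℕ.+ q ℕ.* 16
    p≡3+16q = N.solve 1 (λ q → let 4q = (q N.:+ q) N.:+ (q N.:+ q); h = N.con 1 N.:+ (4q N.:+ 4q) in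
      N.con 1 N.:+ (h N.:+ h) N.:= N.con 3 N.:+ q N.:* N.con 16) refl

  -- Here h = 8q + 1, with 8q written as nested doublings because the counts below supply or remove
  -- one factor 2 at a time.
  %16⇒ : p ℕ.% 16 ≡ 3 → ∃ λ q → h ≡ suc (((q ℕ.+ q) ℕ.+ (q ℕ.+ q)) ℕ.+ ((q ℕ.+ q) ℕ.+ (q ℕ.+ q)))
  %16⇒ e = q , double-injective h (suc (quadruple q ℕ.+ quadruple q)) (ℕ.suc-injective (begin
    suc (h ℕ.+ h)           ≡⟨ p≡2h+1 ⟨
    p                       ≡⟨ ℕ.m≡m%n+[m/n]*n p 16 ⟩
    p ℕ.% 16 ℕ.+ q ℕ.* 16   ≡⟨ cong (ℕ._+ q ℕ.* 16) e ⟩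
    3 ℕ.+ q ℕ.* 16          ≡⟨ p≡3+16q q ⟨
    _                       ∎))
    where
    open ≡-Reasoning
    q = p ℕ./ 16

  ⇒%16 : ∀ q → h ≡ suc (((q ℕ.+ q) ℕ.+ (q ℕ.+ q)) ℕ.+ ((q ℕ.+ q) ℕ.+ (q ℕ.+ q))) → p ℕ.% 16 ≡ 3
  ⇒%16 q refl = trans (cong (ℕ._% 16) (trans p≡2h+1 (p≡3+16q q))) (ℕ.[m+kn]%n≡m%n 3 q 16)

-- The field of residues modulo p, and its nonzero classes up to sign

open import Data.Integer.Base using (ℤ; +_; -_; _+_; _-_; _*_; 0ℤ; 1ℤ; ∣_∣)
open import Data.Integer.DivMod using (_%ℕ_; _/ℕ_; n%ℕd<d; a≡a%ℕn+[a/ℕn]*n)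
open import Data.Integer.Divisibility.Signed using (_∣_; divides; ∣⇒∣ᵤ; ∣ᵤ⇒∣; ∣m∣n⇒∣m+n; ∣n⇒∣m*n; _∣?_)
open import Data.Integer.Properties using (abs-*; pos-*; pos-+; m-n≡m⊖n; ∣m⊖n∣≡∣n⊖m∣; ⊖-≥; *-comm; *-identityˡ; +-identityʳ; -1*i≡-i)
open import Data.Integer.Tactic.RingSolver using (solve; solve-∀)

module Mod (p : ℕ) .{{_ : NonZero p}} where

  infix 4 _≈_ _≉_
  -- A record, so that `a` and `b` can be recovered by unification, which the bare divisibility of
  -- `a - b` would not allow.
  record _≈_ (a b : ℤ) : Set where
    constructor mod
    field difference : + p ∣ a - b

  _≉_ : ℤ → ℤ → Set
  a ≉ b = ¬ a ≈ b

  _≈?_ : ∀ a b → Dec (a ≈ b)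
  a ≈? b = map′ mod _≈_.difference (+ p ∣? (a - b))

  -- e ≈ f by exhibiting e - f as a linear combination of known congruences.
  by₀ : ∀ {e f} → e ≡ f → e ≈ f
  by₀ {e} refl = mod (divides 0ℤ (solve (e ∷ [])))

  by₁ : ∀ {a b e f} c → a ≈ b → e - f ≡ c * (a - b) → e ≈ f
  by₁ c (mod p) eq = mod (subst (+ _ ∣_) (sym eq) (∣n⇒∣m*n c p))

  by₂ : ∀ {a b a′ b′ e f} c c′ → a ≈ b → a′ ≈ b′ →
    e - f ≡ c * (a - b) + c′ * (a′ - b′) → e ≈ f
  by₂ c c′ (mod p) (mod q) eq =
    mod (subst (+ _ ∣_) (sym eq) (∣m∣n⇒∣m+n (∣n⇒∣m*n c p) (∣n⇒∣m*n c′ q)))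

  by₃ : ∀ {a b a′ b′ a″ b″ e f} c c′ c″ → a ≈ b → a′ ≈ b′ → a″ ≈ b″ →
    e - f ≡ c * (a - b) + c′ * (a′ - b′) + c″ * (a″ - b″) → e ≈ f
  by₃ c c′ c″ (mod p) (mod q) (mod r) eq =
    mod (subst (+ _ ∣_) (sym eq)
      (∣m∣n⇒∣m+n (∣m∣n⇒∣m+n (∣n⇒∣m*n c p) (∣n⇒∣m*n c′ q)) (∣n⇒∣m*n c″ r)))

  by₄ : ∀ {a b a′ b′ a″ b″ a‴ b‴ e f} c c′ c″ c‴ → a ≈ b → a′ ≈ b′ → a″ ≈ b″ → a‴ ≈ b‴ →
    e - f ≡ c * (a - b) + c′ * (a′ - b′) + c″ * (a″ - b″) + c‴ * (a‴ - b‴) → e ≈ f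
  by₄ c c′ c″ c‴ (mod p) (mod q) (mod r) (mod s) eq =
    mod (subst (+ _ ∣_) (sym eq)
      (∣m∣n⇒∣m+n (∣m∣n⇒∣m+n (∣m∣n⇒∣m+n (∣n⇒∣m*n c p) (∣n⇒∣m*n c′ q)) (∣n⇒∣m*n c″ r)) (∣n⇒∣m*n c‴ s)))

  ≈-refl : ∀ {a} → a ≈ a
  ≈-refl = by₀ refl

  ≈-sym : ∀ {a b} → a ≈ b → b ≈ a
  ≈-sym {a} {b} q = by₁ (- 1ℤ) q (solve (a ∷ b ∷ []))

  ≈-trans : ∀ {a b c} → a ≈ b → b ≈ c → a ≈ c
  ≈-trans {a} {b} {c} q r = by₂ 1ℤ 1ℤ q r (solve (a ∷ b ∷ c ∷ []))

  *-cong : ∀ {a a′ b b′} → a ≈ a′ → b ≈ b′ → a * b ≈ a′ * b′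
  *-cong {a} {a′} {b} {b′} q r = by₂ b a′ q r (solve (a ∷ a′ ∷ b ∷ b′ ∷ []))

  +-cong : ∀ {a a′ b b′} → a ≈ a′ → b ≈ b′ → a + b ≈ a′ + b′
  +-cong {a} {a′} {b} {b′} q r = by₂ 1ℤ 1ℤ q r (solve (a ∷ a′ ∷ b ∷ b′ ∷ []))

  sq-cong : ∀ {a a′} → a ≈ a′ → a * a ≈ a′ * a′
  sq-cong q = *-cong q q

  residue : ℤ → ℕ
  residue a = a %ℕ p

  residue<p : ∀ a → residue a ℕ.< p
  residue<p a = n%ℕd<d a p

  residue-≈ : ∀ a → + residue a ≈ a
  residue-≈ a = mod (divides (- (a /ℕ p)) (eq (+ residue a) (a /ℕ p) (+ p) a (a≡a%ℕn+[a/ℕn]*n a p)))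
    where
    eq : ∀ r q p a → a ≡ r + q * p → r - a ≡ - q * p
    eq r q p _ refl = solve (r ∷ q ∷ p ∷ [])

  private
    ≤⇒≡ : ∀ {x y} → x ℕ.≤ y → y ℕ.< p → + x ≈ + y → x ≡ y
    ≤⇒≡ {x} {y} x≤y y<p (mod q) with y ℕ.∸ x in eq
    ... | zero  = ℕ.≤-antisym x≤y (ℕ.m∸n≡0⇒m≤n eq)
    ... | suc d = ⊥-elim (ℕ.<⇒≱ (ℕ.≤-<-trans (ℕ.≤-trans (ℕ.≤-reflexive (sym eq)) (ℕ.m∸n≤m y x)) y<p)
                            (ℕ∣.∣⇒≤ (subst (p ℕ∣.∣_) abs (∣⇒∣ᵤ q))))
      where
      abs : ∣ + x - + y ∣ ≡ suc d
      abs = trans (cong ∣_∣ (m-n≡m⊖n x y)) (trans (∣m⊖n∣≡∣n⊖m∣ x y) (trans (cong ∣_∣ (⊖-≥ x≤y)) eq))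

  residue-unique : ∀ {x y} → x ℕ.< p → y ℕ.< p → + x ≈ + y → x ≡ y
  residue-unique {x} {y} x<p y<p q with ℕ.≤-total x y
  ... | inj₁ x≤y = ≤⇒≡ x≤y y<p q
  ... | inj₂ y≤x = sym (≤⇒≡ y≤x x<p (≈-sym q))

  p≈0 : + p ≈ 0ℤ
  p≈0 = mod (divides 1ℤ (solve-p (+ p)))
    where
    solve-p : ∀ a → a - 0ℤ ≡ 1ℤ * a
    solve-p = solve-∀

  module Field (p-prime : Prime p) where

    zero-product : ∀ {a b} → a * b ≈ 0ℤ → a ≈ 0ℤ ⊎ b ≈ 0ℤ
    zero-product {a} {b} (mod q) with euclidsLemma ∣ a ∣ ∣ b ∣ p-prime
      (subst (p ℕ∣.∣_) (trans (cong ∣_∣ (+-identityʳ (a * b))) (abs-* a b)) (∣⇒∣ᵤ q))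
    ... | inj₁ r = inj₁ (mod (subst (+ p ∣_) (sym (+-identityʳ a)) (∣ᵤ⇒∣ r)))
    ... | inj₂ r = inj₂ (mod (subst (+ p ∣_) (sym (+-identityʳ b)) (∣ᵤ⇒∣ r)))

    *-≉0 : ∀ {a b} → a ≉ 0ℤ → b ≉ 0ℤ → a * b ≉ 0ℤ
    *-≉0 a≉0 b≉0 q with zero-product q
    ... | inj₁ r = a≉0 r
    ... | inj₂ r = b≉0 r

    *-cancelˡ : ∀ {a b} c → c ≉ 0ℤ → c * a ≈ c * b → a ≈ b
    *-cancelˡ {a} {b} c c≉0 q = [ ⊥-elim ∘ c≉0 , same ]′
        (zero-product {c} {a - b} (by₁ 1ℤ q (solve (a ∷ b ∷ c ∷ []))))
      where
      same : a - b ≈ 0ℤ → a ≈ b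
      same r = by₁ 1ℤ r (solve (a ∷ b ∷ []))

    sqrt : ∀ {a b} → a * a ≈ b * b → a ≈ b ⊎ a ≈ - b
    sqrt {a} {b} q = Sum.map same opposite (zero-product {a - b} {a + b} (by₁ 1ℤ q (solve (a ∷ b ∷ []))))
      where
      same : a - b ≈ 0ℤ → a ≈ b
      same r = by₁ 1ℤ r (solve (a ∷ b ∷ []))
      opposite : a + b ≈ 0ℤ → a ≈ - b
      opposite r = by₁ 1ℤ r (solve (a ∷ b ∷ []))

    private
      inverse′ : ∀ r → 0 ℕ.< r → r ℕ.< p → ∃ λ b → + r * b ≈ 1ℤ
      inverse′ r@(suc _) 0<r r<p with coprime-Bézout (prime⇒coprime p-prime r<p)
      ... | Bézout.+- x y eq = - + y , mod (divides (- + x) (lem (+ r) (+ y) (+ x) (+ p)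
              (trans (cong (λ i → 1ℤ + i) (sym (pos-* y r))) (trans (sym (pos-+ 1 (y ℕ.* r))) (trans (cong +_ eq) (pos-* x p))))))
        where
        lem : ∀ r y x p → 1ℤ + y * r ≡ x * p → r * - y - 1ℤ ≡ - x * p
        lem r y x p e = trans (lem₁ r y) (trans (cong -_ e) (lem₂ x p))
          where
          lem₁ : ∀ r y → r * - y - 1ℤ ≡ - (1ℤ + y * r)
          lem₁ = solve-∀
          lem₂ : ∀ x p → - (x * p) ≡ - x * p
          lem₂ = solve-∀
      ... | Bézout.-+ x y eq = + y , mod (divides (+ x) (lem (+ r) (+ y) (+ x) (+ p)
              (trans (cong (λ i → 1ℤ + i) (sym (pos-* x p))) (trans (sym (pos-+ 1 (x ℕ.* p))) (trans (cong +_ eq) (pos-* y r))))))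
        where
        lem : ∀ r y x p → 1ℤ + x * p ≡ y * r → r * y - 1ℤ ≡ x * p
        lem r y x p e = trans (cong (_- 1ℤ) (trans (*-comm r y) (sym e))) (solve (x ∷ p ∷ []))

      invertible : ∀ a → a ≉ 0ℤ → ∃ λ b → a * b ≈ 1ℤ
      invertible a a≉0 with residue a | residue<p a | residue-≈ a
      ... | zero  | _ | q = ⊥-elim (a≉0 (≈-sym q))
      ... | suc r | r<p | q = let b , e = inverse′ (suc r) (s≤s z≤n) r<p
                              in b , ≈-trans (*-cong (≈-sym q) ≈-refl) e

    -- Total, with value `0ℤ` on multiples of `p`, so that quotients can be written without carrying
    -- a proof that the denominator is nonzero.
    inv : ℤ → ℤ
    inv a with a ≈? 0ℤ
    ... | yes _   = 0ℤ
    ... | no  a≉0 = proj₁ (invertible a a≉0)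

    inv-inverse : ∀ {a} → a ≉ 0ℤ → a * inv a ≈ 1ℤ
    inv-inverse {a} a≉0 with a ≈? 0ℤ
    ... | yes a≈0 = ⊥-elim (a≉0 a≈0)
    ... | no  a≉0 = proj₂ (invertible a a≉0)

  -- The classes of nonzero residues up to sign are represented by 1, …, h.
  module Halves (p-prime : Prime p) (h : ℕ) (p≡2h+1 : p ≡ suc (h ℕ.+ h)) (2<p : 2 ℕ.< p) where

    open Field p-prime

    Half : ℕ → Set
    Half u = 0 ℕ.< u × u ℕ.≤ h

    h<p : h ℕ.< p
    h<p = subst (h ℕ.<_) (sym p≡2h+1) (s≤s (ℕ.m≤m+n h h))

    half-≉0 : ∀ {u} → Half u → + u ≉ 0ℤ
    half-≉0 (0<u , u≤h) q = ℕ.<-irrefl (sym (residue-unique (ℕ.≤-<-trans u≤h h<p) (ℕ.≤-<-trans z≤n h<p) q)) 0<u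

    ∣_∣ₚ : ℤ → ℕ
    ∣ a ∣ₚ with residue a ℕ.≤? h
    ... | yes _ = residue a
    ... | no  _ = p ℕ.∸ residue a

    ∣∣ₚ-≤h : ∀ a → ∣ a ∣ₚ ℕ.≤ h
    ∣∣ₚ-≤h a with residue a ℕ.≤? h
    ... | yes q = q
    ... | no ¬q = ℕ.≤-trans (ℕ.∸-monoʳ-≤ p (ℕ.≰⇒> ¬q)) (ℕ.≤-reflexive (trans (cong (ℕ._∸ suc h) p≡2h+1) (ℕ.m+n∸m≡n h h)))

    -- Together with `∣∣ₚ-≤h` and `sq-unique` this characterises `∣ a ∣ₚ`, so identities between
    -- classes up to sign can be checked as congruences of squares.
    ∣∣ₚ-sq : ∀ a → + ∣ a ∣ₚ * + ∣ a ∣ₚ ≈ a * a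
    ∣∣ₚ-sq a with residue a ℕ.≤? h
    ... | yes _ = sq-cong (residue-≈ a)
    ... | no  _ = ≈-trans (sq-cong e) (by₀ (neg-sq a))
      where
      neg-sq : ∀ a → - a * - a ≡ a * a
      neg-sq = solve-∀
      r≤p : residue a ℕ.≤ p
      r≤p = ℕ.<⇒≤ (residue<p a)
      lem : ∀ a r p → p - r - - a ≡ 1ℤ * (p - 0ℤ) + - 1ℤ * (r - a)
      lem = solve-∀
      e : + (p ℕ.∸ residue a) ≈ - a
      e = ≈-trans (by₀ (sym (trans (m-n≡m⊖n p (residue a)) (⊖-≥ r≤p))))
        (by₂ 1ℤ (- 1ℤ) p≈0 (residue-≈ a) (lem a (+ residue a) (+ p)))

    ∣∣ₚ-half : ∀ a → a ≉ 0ℤ → Half ∣ a ∣ₚ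
    ∣∣ₚ-half a a≉0 with ∣ a ∣ₚ | ∣∣ₚ-≤h a | ∣∣ₚ-sq a
    ... | suc _ | q | _ = s≤s z≤n , q
    ... | zero  | _ | q = ⊥-elim (*-≉0 a≉0 a≉0 (≈-sym q))

    -- If `u` were congruent to `- v`, then u + v, which is at most 2h = p - 1, would be a multiple
    -- of p and hence zero.
    sq-unique : ∀ {u v} → u ℕ.≤ h → v ℕ.≤ h → + u * + u ≈ + v * + v → u ≡ v
    sq-unique {u} {v} u≤h v≤h q = [ residue-unique (ℕ.≤-<-trans u≤h h<p) (ℕ.≤-<-trans v≤h h<p) , opposite ]′ (sqrt q)
      where
      lem : ∀ u v → u + v - 0ℤ ≡ 1ℤ * (u - - v)
      lem = solve-∀
      opposite : + u ≈ - + v → u ≡ v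
      opposite r = trans (ℕ.m+n≡0⇒m≡0 u u+v≡0) (sym (ℕ.m+n≡0⇒n≡0 u u+v≡0))
        where
        u+v≡0 : u ℕ.+ v ≡ 0
        u+v≡0 = residue-unique (ℕ.≤-<-trans (ℕ.+-mono-≤ u≤h v≤h) (ℕ.≤-reflexive (sym p≡2h+1))) (ℕ.≤-<-trans z≤n h<p)
          (≈-trans (by₀ (pos-+ u v)) (by₁ 1ℤ r (lem (+ u) (+ v))))

    2≉0 : + 2 ≉ 0ℤ
    2≉0 q with residue-unique {2} {0} 2<p (ℕ.≤-<-trans z≤n 2<p) q
    ... | ()

-- The surface, the sign changes N and the orbit representatives

module Surface (p : ℕ) .{{_ : NonZero p}} (p-prime : Prime p) where

  open Mod p
  open Field p-prime

  sign-of : ∀ {a b} → a * a ≈ b * b → ∃ λ ε → ε * ε ≈ 1ℤ × a ≈ ε * b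
  sign-of {a} {b} q = [ same , opposite ]′ (sqrt q)
    where
    same : a ≈ b → ∃ λ ε → ε * ε ≈ 1ℤ × a ≈ ε * b
    same r = 1ℤ , ≈-refl , by₁ 1ℤ r (solve (a ∷ b ∷ []))
    opposite : a ≈ - b → ∃ λ ε → ε * ε ≈ 1ℤ × a ≈ ε * b
    opposite r = - 1ℤ , ≈-refl , by₁ 1ℤ r (solve (a ∷ b ∷ []))

  -- An element of N is given by its signs on x and y; the three signs multiply to 1, which leaves
  -- `ε * δ` for z. Signs are encoded as square roots of 1 rather than as four cases, so that
  -- composition and invariance are ring identities.
  record SignRel (X Y Z X′ Y′ Z′ : ℤ) : Set where
    constructor signRel
    field
      ε δ  : ℤ
      ε²≈1 : ε * ε ≈ 1ℤ
      δ²≈1 : δ * δ ≈ 1ℤ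
      x-eq : X′ ≈ ε * X
      y-eq : Y′ ≈ δ * Y
      z-eq : Z′ ≈ ε * δ * Z

  Surfaceℤ : ℤ → ℤ → ℤ → Set
  Surfaceℤ X Y Z = X * X + Y * Y + Z * Z ≈ X * Y * Z

  module _ {X Y Z X′ Y′ Z′ : ℤ} where

    SignRel-sym : SignRel X Y Z X′ Y′ Z′ → SignRel X′ Y′ Z′ X Y Z
    SignRel-sym (signRel ε δ q r a b c) = signRel ε δ q r
      (by₂ (- ε) (- X) a q (solve (X ∷ X′ ∷ ε ∷ [])))
      (by₂ (- δ) (- Y) b r (solve (Y ∷ Y′ ∷ δ ∷ [])))
      (by₃ (- (ε * δ)) (- (δ * δ * Z)) (- Z) c q r (solve (Z ∷ Z′ ∷ ε ∷ δ ∷ [])))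

    SignRel-trans : ∀ {X″ Y″ Z″} → SignRel X Y Z X′ Y′ Z′ → SignRel X′ Y′ Z′ X″ Y″ Z″ → SignRel X Y Z X″ Y″ Z″
    SignRel-trans {X″} {Y″} {Z″} (signRel ε δ q r a b c) (signRel ε′ δ′ q′ r′ a′ b′ c′) =
      signRel (ε′ * ε) (δ′ * δ)
        (by₂ (ε * ε) 1ℤ q′ q (solve (ε ∷ ε′ ∷ [])))
        (by₂ (δ * δ) 1ℤ r′ r (solve (δ ∷ δ′ ∷ [])))
        (by₂ 1ℤ ε′ a′ a (solve (X ∷ X′ ∷ X″ ∷ ε ∷ ε′ ∷ [])))
        (by₂ 1ℤ δ′ b′ b (solve (Y ∷ Y′ ∷ Y″ ∷ δ ∷ δ′ ∷ [])))
        (by₂ 1ℤ (ε′ * δ′) c′ c (solve (Z ∷ Z′ ∷ Z″ ∷ ε ∷ ε′ ∷ δ ∷ δ′ ∷ [])))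

    SignRel-surface : SignRel X Y Z X′ Y′ Z′ → Surfaceℤ X Y Z → Surfaceℤ X′ Y′ Z′
    SignRel-surface (signRel ε δ q r a b c) s =
      ≈-trans (+-cong (+-cong (sq-cong a) (sq-cong b)) (sq-cong c))
        (≈-trans scaled (≈-sym (*-cong (*-cong a b) c)))
      where
      scaled : Surfaceℤ (ε * X) (δ * Y) (ε * δ * Z)
      scaled = by₃ 1ℤ (X * X + δ * δ * (Z * Z - X * Y * Z)) (Y * Y + (Z * Z - X * Y * Z)) s q r
        (solve (X ∷ Y ∷ Z ∷ ε ∷ δ ∷ []))

    SignRel-m₃ : SignRel X Y Z X′ Y′ Z′ → SignRel X Y (X * Y - Z) X′ Y′ (X′ * Y′ - Z′)
    SignRel-m₃ (signRel ε δ q r a b c) = signRel ε δ q r a b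
      (by₃ Y′ (ε * X) (- 1ℤ) a b c (solve (X ∷ Y ∷ Z ∷ X′ ∷ Y′ ∷ Z′ ∷ ε ∷ δ ∷ [])))

    SignRel-σ₁₂ : SignRel X Y Z X′ Y′ Z′ → SignRel Y X Z Y′ X′ Z′
    SignRel-σ₁₂ (signRel ε δ q r a b c) = signRel δ ε r q b a
      (≈-trans c (by₀ (solve (Z ∷ ε ∷ δ ∷ []))))

    SignRel-σ₂₃ : SignRel X Y Z X′ Y′ Z′ → SignRel X Z Y X′ Z′ Y′
    SignRel-σ₂₃ (signRel ε δ q r a b c) = signRel ε (ε * δ) q
      (by₂ (δ * δ) 1ℤ q r (solve (ε ∷ δ ∷ []))) a c
      (by₂ 1ℤ (- (δ * Y)) b q (solve (Y ∷ Y′ ∷ ε ∷ δ ∷ [])))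

  SignRel-refl : ∀ {X Y Z X′ Y′ Z′} → X′ ≈ X → Y′ ≈ Y → Z′ ≈ Z → SignRel X Y Z X′ Y′ Z′
  SignRel-refl {X} {Y} {Z} {X′} {Y′} {Z′} a b c = signRel 1ℤ 1ℤ ≈-refl ≈-refl
    (by₁ 1ℤ a (solve (X ∷ X′ ∷ []))) (by₁ 1ℤ b (solve (Y ∷ Y′ ∷ []))) (by₁ 1ℤ c (solve (Z ∷ Z′ ∷ [])))

  infix 4 _~_
  _~_ : Triple → Triple → Set
  (x , y , z) ~ (x′ , y′ , z′) = SignRel (+ x) (+ y) (+ z) (+ x′) (+ y′) (+ z′)

  ~-refl : ∀ t → t ~ t
  ~-refl _ = SignRel-refl ≈-refl ≈-refl ≈-refl

  ~-sym : ∀ t t′ → t ~ t′ → t′ ~ t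
  ~-sym _ _ = SignRel-sym

  ~-trans : ∀ t t′ t″ → t ~ t′ → t′ ~ t″ → t ~ t″
  ~-trans _ _ _ = SignRel-trans

  Residues : Triple → Set
  Residues (x , y , z) = x ℕ.< p × y ℕ.< p × z ℕ.< p

  Residues-unique : ∀ {x y z x′ y′ z′} → Residues (x , y , z) → Residues (x′ , y′ , z′) →
    + x ≈ + x′ → + y ≈ + y′ → + z ≈ + z′ → (x , y , z) ≡ (x′ , y′ , z′)
  Residues-unique (a , b , c) (a′ , b′ , c′) q r s
    with refl ← residue-unique a a′ q | refl ← residue-unique b b′ r | refl ← residue-unique c c′ s = refl

  neg-≈ : ∀ {x} → x ℕ.< p → + neg p x ≈ - + x
  neg-≈ {x} x<p = ≈-trans (residue-≈ (+ (p ℕ.∸ x)))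
    (≈-trans (by₀ (sym (trans (m-n≡m⊖n p x) (⊖-≥ (ℕ.<⇒≤ x<p))))) (by₁ 1ℤ p≈0 (lem (+ p) (+ x))))
    where
    lem : ∀ p x → p - x - - x ≡ 1ℤ * (p - 0ℤ)
    lem = solve-∀

  neg<p : ∀ x → neg p x ℕ.< p
  neg<p x = ℕ.m%n<n (p ℕ.∸ x) p

  private
    pos : ∀ x → + x ≈ 1ℤ * + x
    pos x = by₀ (sym (*-identityˡ (+ x)))

    minus : ∀ {x} → x ℕ.< p → + neg p x ≈ - 1ℤ * + x
    minus {x} x<p = ≈-trans (neg-≈ x<p) (by₀ (sym (-1*i≡-i (+ x))))

  Orbit : Triple → Triple → Set
  Orbit t t′ = t′ ≡ t ⊎ t′ ≡ n₁ p t ⊎ t′ ≡ n₂ p t ⊎ t′ ≡ n₃ p t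

  orbit⇒~ : ∀ t {t′} → Residues t → Orbit t t′ → Residues t′ × t ~ t′
  orbit⇒~ t r (inj₁ refl) = r , ~-refl t
  orbit⇒~ (x , y , z) (a , b , c) (inj₂ (inj₁ refl)) = (a , neg<p y , neg<p z) ,
    signRel 1ℤ (- 1ℤ) ≈-refl ≈-refl (pos x) (minus b) (minus c)
  orbit⇒~ (x , y , z) (a , b , c) (inj₂ (inj₂ (inj₁ refl))) = (neg<p x , b , neg<p z) ,
    signRel (- 1ℤ) 1ℤ ≈-refl ≈-refl (minus a) (pos y) (minus c)
  orbit⇒~ (x , y , z) (a , b , c) (inj₂ (inj₂ (inj₂ refl))) = (neg<p x , neg<p y , c) ,
    signRel (- 1ℤ) (- 1ℤ) ≈-refl ≈-refl (minus a) (minus b) (pos z)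

  -- Modulo a prime the only square roots of 1 are 1 and -1, so the pair `ε`, `δ` leaves just the
  -- four elements of N.
  ~⇒orbit : ∀ t t′ → Residues t → Residues t′ → t ~ t′ → Orbit t t′
  ~⇒orbit (x , y , z) (x′ , y′ , z′) t@(a , b , c) t′ (signRel ε δ q r e f g) = cases (sqrt {ε} {1ℤ} q) (sqrt {δ} {1ℤ} r)
    where
    l₁ : ∀ {ε X X′} s → X′ ≈ ε * X → ε ≈ s → X′ ≈ s * X
    l₁ {ε} {X} {X′} s q r = by₂ 1ℤ X q r (solve (ε ∷ X ∷ X′ ∷ s ∷ []))
    l₂ : ∀ {ε δ X X′} s s′ → X′ ≈ ε * δ * X → ε ≈ s → δ ≈ s′ → X′ ≈ s * s′ * X
    l₂ {ε} {δ} {X} {X′} s s′ q r r′ = by₃ 1ℤ (δ * X) (s * X) q r r′ (solve (ε ∷ δ ∷ X ∷ X′ ∷ s ∷ s′ ∷ []))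
    same : ∀ {x x′} → + x′ ≈ 1ℤ * + x → + x′ ≈ + x
    same {x} q = ≈-trans q (≈-sym (pos x))
    opp : ∀ {x x′} → x ℕ.< p → + x′ ≈ - 1ℤ * + x → + x′ ≈ + neg p x
    opp {x} x<p q = ≈-trans q (≈-sym (minus x<p))
    cases : ε ≈ 1ℤ ⊎ ε ≈ - 1ℤ → δ ≈ 1ℤ ⊎ δ ≈ - 1ℤ → Orbit (x , y , z) (x′ , y′ , z′)
    cases (inj₁ u) (inj₁ v) = inj₁ (Residues-unique t′ t
      (same (l₁ 1ℤ e u)) (same (l₁ 1ℤ f v)) (same (l₂ 1ℤ 1ℤ g u v)))
    cases (inj₁ u) (inj₂ v) = inj₂ (inj₁ (Residues-unique t′ (a , neg<p y , neg<p z)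
      (same (l₁ 1ℤ e u)) (opp b (l₁ (- 1ℤ) f v)) (opp c (l₂ 1ℤ (- 1ℤ) g u v))))
    cases (inj₂ u) (inj₁ v) = inj₂ (inj₂ (inj₁ (Residues-unique t′ (neg<p x , b , neg<p z)
      (opp a (l₁ (- 1ℤ) e u)) (same (l₁ 1ℤ f v)) (opp c (l₂ (- 1ℤ) 1ℤ g u v)))))
    cases (inj₂ u) (inj₂ v) = inj₂ (inj₂ (inj₂ (Residues-unique t′ (neg<p x , neg<p y , c)
      (opp a (l₁ (- 1ℤ) e u)) (opp b (l₁ (- 1ℤ) f v)) (same (l₂ (- 1ℤ) (- 1ℤ) g u v)))))

  private
    digits : ∀ {a r a′ r′} → r ℕ.< p → r′ ℕ.< p → a ℕ.* p ℕ.+ r ≡ a′ ℕ.* p ℕ.+ r′ → a ≡ a′ × r ≡ r′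
    digits {a} {r} {a′} {r′} r<p r′<p eq = a≡a′ , r≡r′
      where
      mod-p : ∀ a {r} → r ℕ.< p → (a ℕ.* p ℕ.+ r) ℕ.% p ≡ r
      mod-p a {r} r<p = trans (cong (ℕ._% p) (ℕ.+-comm (a ℕ.* p) r)) (trans (ℕ.[m+kn]%n≡m%n r a p) (ℕ.m<n⇒m%n≡m r<p))
      r≡r′ : r ≡ r′
      r≡r′ = trans (sym (mod-p a r<p)) (trans (cong (ℕ._% p) eq) (mod-p a′ r′<p))
      a≡a′ : a ≡ a′
      a≡a′ = ℕ.*-cancelʳ-≡ a a′ p (ℕ.+-cancelʳ-≡ r (a ℕ.* p) (a′ ℕ.* p) (trans eq (cong (a′ ℕ.* p ℕ.+_) (sym r≡r′))))

  -- `key` is the number with base-p digits x, y, z; `digits` splits off the last digit twice.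
  key-injective : ∀ {t t′} → Residues t → Residues t′ → key p t ≡ key p t′ → t ≡ t′
  key-injective {x , y , z} {x′ , y′ , z′} (a , b , c) (a′ , b′ , c′) eq
    with xy , refl ← digits {x ℕ.* p ℕ.+ y} {z} {x′ ℕ.* p ℕ.+ y′} {z′} c c′
           (trans (cong (ℕ._+ z) (ℕ.*-distribʳ-+ p (x ℕ.* p) y)) (trans eq (cong (ℕ._+ z′) (sym (ℕ.*-distribʳ-+ p (x′ ℕ.* p) y′)))))
    with refl , refl ← digits {x} {y} {x′} {y′} b b′ xy = refl

  minKey-cases : ∀ s t → minKey p s t ≡ s ⊎ minKey p s t ≡ t
  minKey-cases s t with key p t ℕ.<ᵇ key p s
  ... | true  = inj₂ refl
  ... | false = inj₁ refl

  minKey-≤ : ∀ s t → key p (minKey p s t) ℕ.≤ key p s × key p (minKey p s t) ℕ.≤ key p t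
  minKey-≤ s t with key p t ℕ.<ᵇ key p s in eq
  ... | true  = ℕ.<⇒≤ (ℕ.<ᵇ⇒< _ _ (subst T (sym eq) tt)) , ℕ.≤-refl
  ... | false = ℕ.≤-refl , ℕ.≮⇒≥ (λ q → subst T eq (ℕ.<⇒<ᵇ q))

  canon-orbit : ∀ t → Orbit t (canon p t)
  canon-orbit t = [ (λ e → [ (λ f → inj₁ (trans e f)) , (λ f → inj₂ (inj₁ (trans e f))) ]′ (minKey-cases t (n₁ p t))) ,
                    (λ e → [ (λ f → inj₂ (inj₂ (inj₁ (trans e f)))) , (λ f → inj₂ (inj₂ (inj₂ (trans e f)))) ]′ (minKey-cases (n₂ p t) (n₃ p t))) ]′
    (minKey-cases (minKey p t (n₁ p t)) (minKey p (n₂ p t) (n₃ p t)))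

  canon-min : ∀ t {t′} → Orbit t t′ → key p (canon p t) ℕ.≤ key p t′
  canon-min t o with minKey-≤ (minKey p t (n₁ p t)) (minKey p (n₂ p t) (n₃ p t))
                   | minKey-≤ t (n₁ p t) | minKey-≤ (n₂ p t) (n₃ p t)
  canon-min t (inj₁ refl)               | a , b | c , d | e , f = ℕ.≤-trans a c
  canon-min t (inj₂ (inj₁ refl))        | a , b | c , d | e , f = ℕ.≤-trans a d
  canon-min t (inj₂ (inj₂ (inj₁ refl))) | a , b | c , d | e , f = ℕ.≤-trans b e
  canon-min t (inj₂ (inj₂ (inj₂ refl))) | a , b | c , d | e , f = ℕ.≤-trans b f

  canon-residues : ∀ t → Residues t → Residues (canon p t)
  canon-residues t r = proj₁ (orbit⇒~ t r (canon-orbit t))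

  canon-~ : ∀ t → Residues t → t ~ canon p t
  canon-~ t r = proj₂ (orbit⇒~ t r (canon-orbit t))

  -- Each of the two canonical triples lies in the orbit of the other point, so their minimal keys
  -- bound each other.
  canon-cong : ∀ t t′ → Residues t → Residues t′ → t ~ t′ → canon p t ≡ canon p t′
  canon-cong t t′ r r′ q = key-injective (canon-residues t r) (canon-residues t′ r′)
    (ℕ.≤-antisym (canon-min t (~⇒orbit t (canon p t′) r (canon-residues t′ r′) (~-trans t t′ (canon p t′) q (canon-~ t′ r′))))
                 (canon-min t′ (~⇒orbit t′ (canon p t) r′ (canon-residues t r) (~-trans t′ t (canon p t) (~-sym t t′ q) (canon-~ t r)))))

  Origin : Triple
  Origin = 0 , 0 , 0

  OnSurface : Triple → Set
  OnSurface (x , y , z) = Surfaceℤ (+ x) (+ y) (+ z)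

  X* : Triple → Set
  X* t = Residues t × OnSurface t × t ≢ Origin

  record InY (t : Triple) : Set where
    constructor inY
    field
      point   : X* t
      reduced : canon p t ≡ t

  X*-~ : ∀ t t′ → Residues t′ → t ~ t′ → X* t → X* t′
  X*-~ t@(x , y , z) (x′ , y′ , z′) r′ q (r , s , t≢0) = r′ , SignRel-surface q s , λ { refl → t≢0 (t≡0 (SignRel-sym q)) }
    where
    0<p : 0 ℕ.< p
    0<p = ℕ.≤-<-trans z≤n (proj₁ r)
    t≡0 : SignRel 0ℤ 0ℤ 0ℤ (+ x) (+ y) (+ z) → t ≡ Origin
    t≡0 (signRel ε δ _ _ a b c) = Residues-unique r (0<p , 0<p , 0<p)
      (≈-trans a (by₀ (solve (ε ∷ [])))) (≈-trans b (by₀ (solve (δ ∷ [])))) (≈-trans c (by₀ (solve (ε ∷ δ ∷ []))))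

  canon-InY : ∀ t → X* t → InY (canon p t)
  canon-InY t x@(r , _) = inY (X*-~ t (canon p t) (canon-residues t r) (canon-~ t r) x)
    (sym (canon-cong t (canon p t) r (canon-residues t r) (canon-~ t r)))

  private
    pos-sphere : ∀ x y z → + (x ℕ.* x ℕ.+ y ℕ.* y ℕ.+ z ℕ.* z) ≡ + x * + x + + y * + y + + z * + z
    pos-sphere x y z = trans (pos-+ (x ℕ.* x ℕ.+ y ℕ.* y) (z ℕ.* z))
      (cong₂ _+_ (trans (pos-+ (x ℕ.* x) (y ℕ.* y)) (cong₂ _+_ (pos-* x x) (pos-* y y))) (pos-* z z))

    pos-product : ∀ x y z → + (x ℕ.* y ℕ.* z) ≡ + x * + y * + z
    pos-product x y z = trans (pos-* (x ℕ.* y) z) (cong (_* + z) (pos-* x y))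

    onX⇒ : ∀ t → T (onX p t) → OnSurface t
    onX⇒ (x , y , z) q = ≈-trans (by₀ (sym (pos-sphere x y z))) (≈-trans (≈-sym (residue-≈ _))
      (≈-trans (by₀ (cong +_ (ℕ.≡ᵇ⇒≡ _ _ q))) (≈-trans (residue-≈ _) (by₀ (pos-product x y z)))))

    ⇒onX : ∀ t → OnSurface t → T (onX p t)
    ⇒onX (x , y , z) q = ℕ.≡⇒≡ᵇ _ _ (residue-unique (ℕ.m%n<n _ p) (ℕ.m%n<n _ p)
      (≈-trans (residue-≈ _) (≈-trans (by₀ (pos-sphere x y z)) (≈-trans q
        (≈-trans (by₀ (sym (pos-product x y z))) (≈-sym (residue-≈ _)))))))

    nonzeroT⇒ : ∀ t → T (nonzeroT p t) → t ≢ Origin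
    nonzeroT⇒ _ () refl

    ⇒nonzeroT : ∀ t → t ≢ Origin → T (nonzeroT p t)
    ⇒nonzeroT (zero  , zero  , zero)  q = q refl
    ⇒nonzeroT (zero  , zero  , suc _) _ = tt
    ⇒nonzeroT (zero  , suc _ , _)     _ = tt
    ⇒nonzeroT (suc _ , _     , _)     _ = tt

    triples : Enum Residues
    triples = enum (allTriples p)
      (Unique.map⁺ (λ { refl → refl }) (unique cube))
      (λ i → case ∈-map⁻ _ i of λ { ((x , y , z) , j , refl) → sound cube j })
      (λ { {x , y , z} r → ∈-map⁺ _ (complete cube r) })
      where cube = below p ⊗ below p ⊗ below p

    module _ {a b : Bool} where
      open Equivalence (T-∧ {a} {b}) public renaming (to to T-∧⁻; from to T-∧⁺)

  enumY : Enum InY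
  enumY = enum (Y p) (unique E)
    (λ {t} i → let r , q = sound E i
                   s , q′ = T-∧⁻ {onX p t} q
                   n , c = T-∧⁻ {nonzeroT p t} q′
               in inY (r , onX⇒ t s , nonzeroT⇒ t n)
                      (key-injective (canon-residues t r) r (ℕ.≡ᵇ⇒≡ _ _ c)))
    (λ { {t} (inY (r , s , n) c) → complete E (r ,
      T-∧⁺ {onX p t} (⇒onX t s , T-∧⁺ {nonzeroT p t} (⇒nonzeroT t n , ℕ.≡⇒≡ᵇ _ _ (cong (key p) c)))) })
    where E = triples ∩ (λ t → T? (onX p t ∧ nonzeroT p t ∧ isRep p t))

  key-injective-Y : ∀ {t t′} → InY t → InY t′ → key p t ≡ key p t′ → t ≡ t′
  key-injective-Y (inY (r , _) _) (inY (r′ , _) _) = key-injective r r′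

  open Inversions enumY (key p) key-injective-Y public

  inversions-sgn : ∀ f → parity (inversions p f) ≡ sgn f
  inversions-sgn f = cong parity (card-cong (enumY ⊗ enumY ∩ (λ ab → T? _)) (inversionEnum f)
    (λ { {a , b} (i , q) → let r , s = T-∧⁻ {key p a ℕ.<ᵇ key p b} q in i , ℕ.<ᵇ⇒< _ _ r , ℕ.<ᵇ⇒< _ _ s })
    (λ { {a , b} (i , r , s) → i , T-∧⁺ {key p a ℕ.<ᵇ key p b} (ℕ.<⇒<ᵇ r , ℕ.<⇒<ᵇ s) }))

  -- Involutions induced on the orbits

  record Equivariant (φ : Triple → Triple) : Set where
    field
      φ-residues : ∀ t → Residues t → Residues (φ t)
      φ-surface  : ∀ t → Residues t → OnSurface t → OnSurface (φ t)
      φ-~        : ∀ t t′ → Residues t → Residues t′ → t ~ t′ → φ t ~ φ t′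
      φ-invol    : ∀ t → Residues t → φ (φ t) ≡ t
      -- With `φ-invol`, this prevents a nonzero point from being sent to the origin.
      φ-origin   : φ Origin ≡ Origin

    induced : Triple → Triple
    induced = canon p ∘ φ

    φ-X* : ∀ t → X* t → X* (φ t)
    φ-X* t (r , s , t≢0) = φ-residues t r , φ-surface t r s ,
      λ e → t≢0 (trans (sym (φ-invol t r)) (trans (cong φ e) φ-origin))

    induced-canon : ∀ t → Residues t → induced (canon p t) ≡ induced t
    induced-canon t r = canon-cong (φ (canon p t)) (φ t) (φ-residues _ c) (φ-residues t r)
      (φ-~ (canon p t) t c r (~-sym t (canon p t) (canon-~ t r)))
      where c = canon-residues t r

    induced-maps : ∀ {t} → InY t → InY (induced t)
    induced-maps {t} (inY x _) = canon-InY (φ t) (φ-X* t x)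

    induced-invol : ∀ {t} → InY t → induced (induced t) ≡ t
    induced-invol {t} (inY (r , _) c) = trans (induced-canon (φ t) (φ-residues t r)) (trans (cong (canon p) (φ-invol t r)) c)

    induced-permutation : IsPermutation induced
    induced-permutation = record
      { inverse  = induced
      ; maps     = induced-maps
      ; maps⁻¹   = induced-maps
      ; inverseˡ = induced-invol
      ; inverseʳ = induced-invol
      }

    induced-≡ : ∀ {t t′} → InY t → InY t′ → φ t ~ t′ → t′ ≡ induced t
    induced-≡ {t} {t′} (inY (r , _) _) (inY (r′ , _) c′) q =
      trans (sym c′) (sym (canon-cong (φ t) t′ (φ-residues t r) r′ q))

  m₃-≈ : ∀ {x y z} → z ℕ.< p → + ((x ℕ.* y ℕ.+ neg p z) ℕ.% p) ≈ + x * + y - + z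
  m₃-≈ {x} {y} {z} z<p = ≈-trans (residue-≈ _)
    (≈-trans (by₀ (trans (pos-+ (x ℕ.* y) (neg p z)) (cong (_+ + neg p z) (pos-* x y)))) (+-cong (≈-refl {+ x * + y}) (neg-≈ z<p)))

  m₃-equivariant : Equivariant (actGen p m₃)
  m₃-equivariant = record
    { φ-residues = λ (x , y , z) (a , b , _) → a , b , ℕ.m%n<n (x ℕ.* y ℕ.+ neg p z) p
    ; φ-surface  = λ (x , y , z) (_ , _ , c) s →
        SignRel-surface {+ x} {+ y} {+ x * + y - + z} {+ x} {+ y}
          (SignRel-refl ≈-refl ≈-refl (m₃-≈ {x} {y} c)) (surface (+ x) (+ y) (+ z) s)
    ; φ-~        = λ (x , y , z) (x′ , y′ , z′) (_ , _ , c) (_ , _ , c′) q →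
        SignRel-trans (SignRel-refl ≈-refl ≈-refl (≈-sym (m₃-≈ {x} {y} c)))
          (SignRel-trans (SignRel-m₃ q) (SignRel-refl ≈-refl ≈-refl (m₃-≈ {x′} {y′} c′)))
    ; φ-invol    = λ (x , y , z) (a , b , c) → let z′<p = ℕ.m%n<n (x ℕ.* y ℕ.+ neg p z) p in
        cong (λ z → x , y , z) (residue-unique (ℕ.m%n<n _ p) c
          (≈-trans (m₃-≈ {x} {y} z′<p) (twice (+ x * + y) (m₃-≈ {x} {y} c))))
    ; φ-origin   = cong (λ z → 0 , 0 , z) (residue-unique (ℕ.m%n<n _ p) 0<p (m₃-≈ {0} {0} 0<p))
    }
    where
    surface : ∀ X Y Z → Surfaceℤ X Y Z → Surfaceℤ X Y (X * Y - Z)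
    surface X Y Z s = by₁ 1ℤ s (solve (X ∷ Y ∷ Z ∷ []))
    twice : ∀ {Z Z′} XY → Z′ ≈ XY - Z → XY - Z′ ≈ Z
    twice {Z} {Z′} XY q = by₁ (- 1ℤ) q (solve (Z ∷ Z′ ∷ XY ∷ []))
    0<p : 0 ℕ.< p
    0<p = ℕ.>-nonZero⁻¹ p

  σ₁₂-equivariant : Equivariant (actGen p σ₁₂)
  σ₁₂-equivariant = record
    { φ-residues = λ _ (a , b , c) → b , a , c
    ; φ-surface  = λ (x , y , z) _ → surface (+ x) (+ y) (+ z)
    ; φ-~        = λ _ _ _ _ → SignRel-σ₁₂
    ; φ-invol    = λ _ _ → refl
    ; φ-origin   = refl
    }
    where
    surface : ∀ X Y Z → Surfaceℤ X Y Z → Surfaceℤ Y X Z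
    surface X Y Z s = by₁ 1ℤ s (solve (X ∷ Y ∷ Z ∷ []))

  σ₂₃-equivariant : Equivariant (actGen p σ₂₃)
  σ₂₃-equivariant = record
    { φ-residues = λ _ (a , b , c) → a , c , b
    ; φ-surface  = λ (x , y , z) _ → surface (+ x) (+ y) (+ z)
    ; φ-~        = λ _ _ _ _ → SignRel-σ₂₃
    ; φ-invol    = λ _ _ → refl
    ; φ-origin   = refl
    }
    where
    surface : ∀ X Y Z → Surfaceℤ X Y Z → Surfaceℤ X Z Y
    surface X Y Z s = by₁ 1ℤ s (solve (X ∷ Y ∷ Z ∷ []))

  -- Reduction of words to three basic involutions

  data Base : Set where
    s₁₂ s₂₃ r₃ : Base

  toGen : Base → Gen p
  toGen s₁₂ = σ₁₂
  toGen s₂₃ = σ₂₃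
  toGen r₃ = m₃

  equivariant : ∀ β → Equivariant (actGen p (toGen β))
  equivariant s₁₂ = σ₁₂-equivariant
  equivariant s₂₃ = σ₂₃-equivariant
  equivariant r₃ = m₃-equivariant

  actBase inducedBase : List Base → Triple → Triple
  actBase     = foldr (λ β f → actGen p (toGen β) ∘ f) id
  inducedBase = foldr (λ β f → inducedGen p (toGen β) ∘ f) id

  actBase-residues : ∀ w t → Residues t → Residues (actBase w t)
  actBase-residues []      t r = r
  actBase-residues (β ∷ w) t r = Equivariant.φ-residues (equivariant β) (actBase w t) (actBase-residues w t r)

  -- By equivariance the representative may be taken once at the end instead of after every letter.
  -- Identities between words can thus be checked on plain triples, where they hold by computation.
  inducedBase-canon : ∀ w {t} → InY t → inducedBase w t ≡ canon p (actBase w t)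
  inducedBase-canon []      (inY _ c) = sym c
  inducedBase-canon (β ∷ w) {t} i@(inY (r , _) _) =
    trans (cong (inducedGen p (toGen β)) (inducedBase-canon w i))
          (Equivariant.induced-canon (equivariant β) (actBase w t) (actBase-residues w t r))

  inducedBase-permutation : ∀ w → IsPermutation (inducedBase w)
  inducedBase-permutation []      = id-permutation
  inducedBase-permutation (β ∷ w) =
    ∘-permutation (Equivariant.induced-permutation (equivariant β)) (inducedBase-permutation w)

  sgnBase : Base → Parity
  sgnBase β = sgn (inducedGen p (toGen β))

  sumBase : (Base → Parity) → List Base → Parity
  sumBase s = foldr (λ β r → s β ℙ.+ r) 0ℙ

  sgn-inducedBase : ∀ w → sgn (inducedBase w) ≡ sumBase sgnBase w
  sgn-inducedBase []      = sgn-id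
  sgn-inducedBase (β ∷ w) =
    trans (sgn-∘ (Equivariant.induced-permutation (equivariant β)) (inducedBase-permutation w))
          (cong (sgnBase β ℙ.+_) (sgn-inducedBase w))

  expand : Gen p → List Base
  expand m₁   = s₁₂ ∷ s₂₃ ∷ r₃ ∷ s₂₃ ∷ s₁₂ ∷ []
  expand m₂   = s₂₃ ∷ r₃ ∷ s₂₃ ∷ []
  expand m₃   = r₃ ∷ []
  expand σid  = []
  expand σ₁₂  = s₁₂ ∷ []
  expand σ₁₃  = s₁₂ ∷ s₂₃ ∷ s₁₂ ∷ []
  expand σ₂₃  = s₂₃ ∷ []
  expand σ₁₂₃ = s₂₃ ∷ s₁₂ ∷ []
  expand σ₁₃₂ = s₁₂ ∷ s₂₃ ∷ []

  expand-act : ∀ g t → actGen p g t ≡ actBase (expand g) t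
  expand-act m₁   _ = refl
  expand-act m₂   _ = refl
  expand-act m₃   _ = refl
  expand-act σid  _ = refl
  expand-act σ₁₂  _ = refl
  expand-act σ₁₃  _ = refl
  expand-act σ₂₃  _ = refl
  expand-act σ₁₂₃ _ = refl
  expand-act σ₁₃₂ _ = refl

  act⇒induced : ∀ g w → (∀ t → actGen p g t ≡ actBase w t) → ∀ {t} → InY t → inducedGen p g t ≡ inducedBase w t
  act⇒induced g w eq {t} i = trans (cong (canon p) (eq t)) (sym (inducedBase-canon w i))

  expand-induced : ∀ g {t} → InY t → inducedGen p g t ≡ inducedBase (expand g) t
  expand-induced g = act⇒induced g (expand g) (expand-act g)

  -- σ₂₃ = σ₁₂σ₂₃σ₁₂σ₂₃σ₁₂ by the braid relation.
  sgn-s₂₃ : sgnBase s₂₃ ≡ sgnBase s₁₂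
  sgn-s₂₃ = trans (sgn-cong (act⇒induced σ₂₃ w (λ _ → refl))) (trans (sgn-inducedBase w) (collapse sgnBase))
    where
    w = s₁₂ ∷ s₂₃ ∷ s₁₂ ∷ s₂₃ ∷ s₁₂ ∷ []
    collapse : ∀ s → sumBase s w ≡ s s₁₂
    collapse s with s s₁₂ | s s₂₃
    ... | 0ℙ | 0ℙ = refl
    ... | 0ℙ | 1ℙ = refl
    ... | 1ℙ | 0ℙ = refl
    ... | 1ℙ | 1ℙ = refl

  -- Agreement can be claimed only on `Y`: `σid` induces `canon p`, while its expansion, the empty
  -- word, induces the identity, and these coincide only on reduced triples.
  inducedWord-base : ∀ w → ∃ λ v → ∀ {t} → InY t → inducedWord p w t ≡ inducedBase v t
  inducedWord-base []      = [] , λ _ → refl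
  inducedWord-base (g ∷ w) with inducedWord-base w
  ... | v , eq = expand g ++ v , λ {t} i →
    trans (cong (inducedGen p g) (eq i))
      (trans (expand-induced g (IsPermutation.maps (inducedBase-permutation v) i)) (sym (++-induced (expand g) v t)))
    where
    ++-induced : ∀ w v t → inducedBase (w ++ v) t ≡ inducedBase w (inducedBase v t)
    ++-induced []      v t = refl
    ++-induced (β ∷ w) v t = cong (inducedGen p (toGen β)) (++-induced w v t)

  HinAlt⇒ : HinAlt p → ∀ β → sgnBase β ≡ 0ℙ
  HinAlt⇒ H β = trans (sgn-cong {inducedGen p (toGen β)} {inducedWord p w} (λ _ → refl))
      (trans (sym (inversions-sgn (inducedWord p w)))
             (%2⇒parity (inversions p (inducedWord p w)) (H w)))
    where w = toGen β ∷ []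

  sumBase-zero : ∀ s → (∀ β → s β ≡ 0ℙ) → ∀ v → sumBase s v ≡ 0ℙ
  sumBase-zero s z []      = refl
  sumBase-zero s z (β ∷ v) = cong₂ ℙ._+_ (z β) (sumBase-zero s z v)

  sgn-inducedWord : (∀ β → sgnBase β ≡ 0ℙ) → ∀ w → sgn (inducedWord p w) ≡ 0ℙ
  sgn-inducedWord z w = let v , eq = inducedWord-base w in
    trans (sgn-cong {inducedWord p w} {inducedBase v} eq) (trans (sgn-inducedBase v) (sumBase-zero sgnBase z v))

  ⇒HinAlt : (∀ β → sgnBase β ≡ 0ℙ) → HinAlt p
  ⇒HinAlt z w = parity⇒%2 (inversions p (inducedWord p w))
    (trans (inversions-sgn (inducedWord p w)) (sgn-inducedWord z w))

  HinAlt-from : sgnBase r₃ ≡ 0ℙ → sgnBase s₁₂ ≡ 0ℙ → HinAlt p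
  HinAlt-from sm sa = ⇒HinAlt z
    where
    z : ∀ β → sgnBase β ≡ 0ℙ
    z s₁₂ = sa
    z s₂₃ = trans sgn-s₂₃ sa
    z r₃ = sm

-- Sphere coordinates

module OddPrime (p : ℕ) .{{_ : NonZero p}} (p-prime : Prime p)
  (h : ℕ) (p≡2h+1 : p ≡ suc (h ℕ.+ h)) (2<p : 2 < p)
  where

  open Mod p
  open Field p-prime
  open Halves p-prime h p≡2h+1 2<p
  open Surface p p-prime

  record Sphere (U V W : ℤ) : Set where
    constructor sphere
    field equation : U * U + V * V + W * W ≈ 1ℤ

  sphere? : ∀ U V W → Dec (Sphere U V W)
  sphere? U V W = map′ sphere Sphere.equation (_ ≈? _)

  -- U = ± 2/X, V = ± 2/Y, W = (2Z - XY)/(XY).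
  record Coord (X Y Z U V W : ℤ) : Set where
    constructor coord
    field
      xu : X * X * (U * U) ≈ + 4
      yv : Y * Y * (V * V) ≈ + 4
      w  : W * (X * Y) ≈ + 2 * Z - X * Y

  4≉0 : + 4 ≉ 0ℤ
  4≉0 = *-≉0 2≉0 2≉0

  private
    factor-≉0 : ∀ {X U} → X * X * (U * U) ≈ + 4 → X ≉ 0ℤ
    factor-≉0 {X} {U} q r = 4≉0 (by₂ (- 1ℤ) (X * (U * U)) q r (solve (X ∷ U ∷ [])))

  module _ {X Y Z U V W : ℤ} where

    Coord-σ₁₂ : Coord X Y Z U V W → Coord Y X Z V U W
    Coord-σ₁₂ (coord a b c) = coord b a (by₁ 1ℤ c (solve (X ∷ Y ∷ Z ∷ W ∷ [])))

    Coord-m₃ : Coord X Y Z U V W → Coord X Y (X * Y - Z) U V (- W)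
    Coord-m₃ (coord a b c) = coord a b (by₁ (- 1ℤ) c (solve (X ∷ Y ∷ Z ∷ W ∷ [])))

    Coord-W : ∀ {W′} → W ≈ W′ → Coord X Y Z U V W → Coord X Y Z U V W′
    Coord-W {W′} q (coord a b c) = coord a b (by₂ (- (X * Y)) 1ℤ q c (solve (X ∷ Y ∷ Z ∷ W ∷ W′ ∷ [])))

    Coord-sphere : Surfaceℤ X Y Z → Coord X Y Z U V W → Sphere U V W
    Coord-sphere s (coord a b c) = sphere (*-cancelˡ (X * X * (Y * Y))
      (*-≉0 (*-≉0 x≉0 x≉0) (*-≉0 y≉0 y≉0)) scaled)
      where
      x≉0 = factor-≉0 {X} {U} a
      y≉0 = factor-≉0 {Y} {V} b
      scaled : X * X * (Y * Y) * (U * U + V * V + W * W) ≈ X * X * (Y * Y) * 1ℤ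
      scaled = by₄ (Y * Y) (X * X) (W * (X * Y) + (+ 2 * Z - X * Y)) (+ 4) a b c s
        (solve (X ∷ Y ∷ Z ∷ U ∷ V ∷ W ∷ []))

    Coord-surface : Sphere U V W → Coord X Y Z U V W → Surfaceℤ X Y Z
    Coord-surface (sphere s) (coord a b c) = *-cancelˡ (+ 4) 4≉0 scaled
      where
      scaled : + 4 * (X * X + Y * Y + Z * Z) ≈ + 4 * (X * Y * Z)
      scaled = by₄ (- (Y * Y)) (- (X * X)) (- (W * (X * Y) + (+ 2 * Z - X * Y))) (X * X * (Y * Y)) a b c s
        (solve (X ∷ Y ∷ Z ∷ U ∷ V ∷ W ∷ []))

    -- A sign change multiplies both Z and XY by `ε * δ`, so W is unaffected, and U and V enter only
    -- through their squares.
    Coord-~ : ∀ {X′ Y′ Z′} → SignRel X Y Z X′ Y′ Z′ → Coord X Y Z U V W → Coord X′ Y′ Z′ U V W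
    Coord-~ {X′} {Y′} {Z′} (signRel ε δ q r d e f) (coord a b c) = coord
      (by₃ (U * U * (X′ + ε * X)) (U * U * (X * X)) 1ℤ d q a (solve (X ∷ X′ ∷ U ∷ ε ∷ [])))
      (by₃ (V * V * (Y′ + δ * Y)) (V * V * (Y * Y)) 1ℤ e r b (solve (Y ∷ Y′ ∷ V ∷ δ ∷ [])))
      (by₄ ((W + 1ℤ) * Y′) ((W + 1ℤ) * (ε * X)) (- + 2) (ε * δ) d e f c
        (solve (X ∷ Y ∷ Z ∷ X′ ∷ Y′ ∷ Z′ ∷ W ∷ ε ∷ δ ∷ [])))

    -- U² and V² fix X and Y up to independent signs, and 2Z = (W + 1)XY then makes Z follow the
    -- product of these signs.
    Coord-unique : ∀ {X′ Y′ Z′} → U ≉ 0ℤ → V ≉ 0ℤ → Coord X Y Z U V W → Coord X′ Y′ Z′ U V W →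
      SignRel X Y Z X′ Y′ Z′
    Coord-unique {X′} {Y′} {Z′} u≉0 v≉0 (coord a b c) (coord a′ b′ c′) =
      signs (sign-of {X′} {X} (*-cancelˡ (U * U) (*-≉0 u≉0 u≉0) x²))
            (sign-of {Y′} {Y} (*-cancelˡ (V * V) (*-≉0 v≉0 v≉0) y²))
      where
      x² : U * U * (X′ * X′) ≈ U * U * (X * X)
      x² = by₂ 1ℤ (- 1ℤ) a′ a (solve (X ∷ X′ ∷ U ∷ []))
      y² : V * V * (Y′ * Y′) ≈ V * V * (Y * Y)
      y² = by₂ 1ℤ (- 1ℤ) b′ b (solve (Y ∷ Y′ ∷ V ∷ []))
      signs : (∃ λ ε → ε * ε ≈ 1ℤ × X′ ≈ ε * X) → (∃ λ δ → δ * δ ≈ 1ℤ × Y′ ≈ δ * Y) →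
              SignRel X Y Z X′ Y′ Z′
      signs (ε , q , d) (δ , r , e) = signRel ε δ q r d e (*-cancelˡ (+ 2) 2≉0 z)
        where
        z : + 2 * Z′ ≈ + 2 * (ε * δ * Z)
        z = by₄ (- 1ℤ) ((W + 1ℤ) * Y′) ((W + 1ℤ) * (ε * X)) (ε * δ) c′ d e c
          (solve (X ∷ Y ∷ Z ∷ X′ ∷ Y′ ∷ Z′ ∷ W ∷ ε ∷ δ ∷ []))

    Coord-functional : ∀ {U′ V′ W′} → Coord X Y Z U V W → Coord X Y Z U′ V′ W′ →
      U * U ≈ U′ * U′ × V * V ≈ V′ * V′ × W ≈ W′
    Coord-functional {U′} {V′} {W′} (coord a b c) (coord a′ b′ c′) =
      *-cancelˡ (X * X) (*-≉0 x≉0 x≉0) (≈-trans a (≈-sym a′)) ,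
      *-cancelˡ (Y * Y) (*-≉0 y≉0 y≉0) (≈-trans b (≈-sym b′)) ,
      *-cancelˡ (X * Y) (*-≉0 x≉0 y≉0) w
      where
      x≉0 = factor-≉0 {X} {U} a
      y≉0 = factor-≉0 {Y} {V} b
      w : X * Y * W ≈ X * Y * W′
      w = by₂ 1ℤ (- 1ℤ) c c′ (solve (X ∷ Y ∷ Z ∷ W ∷ W′ ∷ []))

  CoordOf : Triple → Triple → Set
  CoordOf (x , y , z) (u , v , w) = Coord (+ x) (+ y) (+ z) (+ u) (+ v) (+ w)

  halfQuotient : ∀ a b → a ≉ 0ℤ → b ≉ 0ℤ → ∃ λ u → Half u × b * b * (+ u * + u) ≈ a * a
  halfQuotient a b a≉0 b≉0 = ∣ c ∣ₚ , ∣∣ₚ-half c c≉0 , lem (+ ∣ c ∣ₚ) (inv b) (∣∣ₚ-sq c) b*b⁻¹≈1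
    where
    c = a * inv b
    b*b⁻¹≈1 = inv-inverse b≉0
    lem : ∀ u b⁻¹ → u * u ≈ a * b⁻¹ * (a * b⁻¹) → b * b⁻¹ ≈ 1ℤ → b * b * (u * u) ≈ a * a
    lem u b⁻¹ q r = by₂ (b * b) (a * a * (b * b⁻¹ + 1ℤ)) q r (solve (a ∷ b ∷ u ∷ b⁻¹ ∷ []))
    c≉0 : c ≉ 0ℤ
    c≉0 q = a≉0 (lem′ (inv b) q b*b⁻¹≈1)
      where
      lem′ : ∀ b⁻¹ → a * b⁻¹ ≈ 0ℤ → b * b⁻¹ ≈ 1ℤ → a ≈ 0ℤ
      lem′ b⁻¹ q r = by₂ b (- a) q r (solve (a ∷ b ∷ b⁻¹ ∷ []))

  point : ∀ u v w → + u ≉ 0ℤ → + v ≉ 0ℤ → Sphere (+ u) (+ v) (+ w) → ∃ λ t → InY t × CoordOf t (u , v , w)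
  point u v w u≉0 v≉0 s = canon p t , canon-InY t (r , Coord-surface {+ x} {+ y} {+ z} s c , t≢0) , Coord-~ (canon-~ t r) c
    where
    X = + 2 * inv (+ u)
    Y′ = + 2 * inv (+ v)
    -- This solves 2Z = (1 + W)XY, since half of Y is the inverse of v.
    Z = (1ℤ + + w) * X * inv (+ v)
    x = residue X
    y = residue Y′
    z = residue Z
    t : Triple
    t = x , y , z
    r : Residues t
    r = residue<p X , residue<p Y′ , residue<p Z
    side : ∀ U I → U * I ≈ 1ℤ → + 2 * I * (+ 2 * I) * (U * U) ≈ + 4
    side U I q = by₁ (+ 4 * (U * I + 1ℤ)) q (solve (U ∷ I ∷ []))
    last : ∀ W I J → W * (+ 2 * I * (+ 2 * J)) ≡ + 2 * ((1ℤ + W) * (+ 2 * I) * J) - + 2 * I * (+ 2 * J)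
    last = solve-∀
    c : CoordOf t (u , v , w)
    c = Coord-~ (SignRel-refl (residue-≈ X) (residue-≈ Y′) (residue-≈ Z))
          (coord (side (+ u) (inv (+ u)) (inv-inverse u≉0)) (side (+ v) (inv (+ v)) (inv-inverse v≉0))
                 (by₀ (last (+ w) (inv (+ u)) (inv (+ v)))))
    t≢0 : t ≢ Origin
    t≢0 e = factor-≉0 {+ x} {+ u} (Coord.xu c) (by₀ (cong (+_ ∘ proj₁) e))

  -- A 2-cycle is represented by the triple of `Q` that coordinatises one of its two members. By
  -- `total` every moved orbit has such a triple. By `apart` its two members never both have
  -- coordinates in `Q`, which makes the triple unique and shows that every triple of `Q` comes from
  -- a moved orbit.
  module Cycles {φ : Triple → Triple} (Φ : Equivariant φ) {Q : Triple → Set} (E : Enum Q)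
    (Q⇒ : ∀ {u v w} → Q (u , v , w) → Half u × Half v × w ℕ.< p × Sphere (+ u) (+ v) (+ w))
    (total : ∀ t → InY t → ¬ φ t ~ t → ∃ λ b → Q b × (CoordOf t b ⊎ CoordOf (φ t) b))
    (apart : ∀ t b b′ → Residues t → Q b → Q b′ → CoordOf t b → CoordOf (φ t) b′ → ⊥)
    where

    open Equivariant Φ

    private
      residues : ∀ {t} → InY t → Residues t
      residues (inY (r , _) _) = r

      k-fix : ∀ {t} → InY t → key p (induced t) ≡ key p t → induced t ≡ t
      k-fix i = key-injective (residues (induced-maps i)) (residues i)

      open Involution {P = InY} induced (key p) induced-maps induced-invol k-fix

      R : Triple → Triple → Set
      R t b = CoordOf t b ⊎ CoordOf (φ t) b

      φt~induced : ∀ {t} → InY t → φ t ~ induced t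
      φt~induced {t} i = canon-~ (φ t) (φ-residues t (residues i))

      R-induced : ∀ {t b} → InY t → Q b → R t b → R (induced t) b
      R-induced {t} i _ (inj₂ c) = inj₁ (Coord-~ (φt~induced i) c)
      R-induced {t} {b} i _ (inj₁ c) = inj₂ (Coord-~ t~φi c)
        where
        t~φi : t ~ φ (induced t)
        t~φi = subst (_~ φ (induced t)) (φ-invol t (residues i))
          (φ-~ (φ t) (induced t) (φ-residues t (residues i)) (residues (induced-maps i)) (φt~induced i))

      totˡ : ∀ {t} → InY t → induced t ≢ t → ∃ λ b → Q b × R t b
      totˡ {t} i ne = total t i λ q → ne (sym (induced-≡ i i q))

      totʳ : ∀ {b} → Q b → ∃ λ t → InY t × induced t ≢ t × R t b
      totʳ {b@(u , v , w)} q =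
        let hu , hv , _ , s = Q⇒ q
            t , i , c = point u v w (half-≉0 hu) (half-≉0 hv) s
        in t , i , (λ e → apart t b b (residues i) q q c
             (Coord-~ (SignRel-sym (subst (φ t ~_) e (φt~induced i))) c)) , inj₁ c

      unique-~ : ∀ t t′ {b} → Q b → CoordOf t b → CoordOf t′ b → t ~ t′
      unique-~ t t′ q c c′ = let hu , hv , _ = Q⇒ q in Coord-unique (half-≉0 hu) (half-≉0 hv) c c′

      injˡ : ∀ {t t′ b} → InY t → InY t′ → Q b → R t b → R t′ b → t′ ≡ t ⊎ t′ ≡ induced t
      injˡ {t} {t′} i i′ q (inj₁ c) (inj₁ c′) = inj₁ (canonical i i′ (unique-~ t t′ q c c′))
        where
        canonical : ∀ {t t′} → InY t → InY t′ → t ~ t′ → t′ ≡ t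
        canonical {t} {t′} (inY (r , _) e) (inY (r′ , _) e′) q = trans (sym e′) (trans (sym (canon-cong t t′ r r′ q)) e)
      injˡ {t} {t′} i i′ q (inj₂ c) (inj₁ c′) = inj₂ (induced-≡ i i′ (unique-~ (φ t) t′ q c c′))
      injˡ {t} {t′} i i′ q (inj₁ c) (inj₂ c′) = inj₂ (induced-≡ i i′
        (subst (φ t ~_) (φ-invol t′ (residues i′))
          (φ-~ t (φ t′) (residues i) (φ-residues t′ (residues i′)) (unique-~ t (φ t′) q c c′))))
      injˡ {t} {t′} i i′ q (inj₂ c) (inj₂ c′) = inj₁ (begin
        t′                   ≡⟨ induced-invol i′ ⟨
        induced (induced t′) ≡⟨ cong induced (canon-cong (φ t) (φ t′) (φ-residues t (residues i))
                                  (φ-residues t′ (residues i′)) (unique-~ (φ t) (φ t′) q c c′)) ⟨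
        induced (induced t)  ≡⟨ induced-invol i ⟩
        t                    ∎)
        where open ≡-Reasoning

      functional : ∀ t {b b′} → Q b → Q b′ → CoordOf t b → CoordOf t b′ → b ≡ b′
      functional t q q′ c c′ =
        let (_ , u≤h) , (_ , v≤h) , w<p , _ = Q⇒ q
            (_ , u′≤h) , (_ , v′≤h) , w′<p , _ = Q⇒ q′
            eu , ev , ew = Coord-functional c c′
        in cong₂ _,_ (sq-unique u≤h u′≤h eu) (cong₂ _,_ (sq-unique v≤h v′≤h ev) (residue-unique w<p w′<p ew))

      injʳ : ∀ {t b b′} → InY t → Q b → Q b′ → R t b → R t b′ → b ≡ b′
      injʳ {t} i q q′ (inj₁ c) (inj₁ c′) = functional t q q′ c c′
      injʳ {t} i q q′ (inj₂ c) (inj₂ c′) = functional (φ t) q q′ c c′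
      injʳ {t} i q q′ (inj₁ c) (inj₂ c′) = ⊥-elim (apart t _ _ (residues i) q q′ c c′)
      injʳ {t} i q q′ (inj₂ c) (inj₁ c′) = ⊥-elim (apart t _ _ (residues i) q′ q c′ c)

    sgn-induced : sgn induced ≡ parity (card E)
    sgn-induced = trans (sgn-involution induced induced-maps induced-invol (ascents enumY))
      (cong parity (card-ascents (ascents enumY) E R R-induced totˡ totʳ injˡ injʳ))

  -- The 2-cycles of m₃ and σ₁₂ as points of the sphere

  halves : Enum Half
  halves = from1to h

  -- A 2-cycle of m₃ consists of w and -w, so w is taken nonzero and up to sign. For σ₁₂ the third
  -- coordinate is a full residue, zero included, and `u ℕ.< v` selects one of the two orders.
  MoveCycle SwapCycle : Triple → Set
  MoveCycle (u , v , w) = (Half u × Half v × Half w) × Sphere (+ u) (+ v) (+ w)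
  SwapCycle (u , v , w) = (Half u × Half v × w ℕ.< p) × (u ℕ.< v × Sphere (+ u) (+ v) (+ w))

  moveCycles : Enum MoveCycle
  moveCycles = halves ⊗ halves ⊗ halves ∩ (λ (u , v , w) → sphere? (+ u) (+ v) (+ w))

  swapCycles : Enum SwapCycle
  swapCycles = halves ⊗ halves ⊗ below p ∩ (λ (u , v , w) → (u ℕ.<? v) ×-dec sphere? (+ u) (+ v) (+ w))

  private
    -- With X = 0 the move only negates Z, which is the effect of the sign change n₂.
    fixed-x : ∀ {X Y Z Z′} → X ≈ 0ℤ → Z′ ≈ X * Y - Z → SignRel X Y Z X Y Z′
    fixed-x {X} {Y} {Z} {Z′} q r = signRel (- 1ℤ) 1ℤ ≈-refl ≈-refl
      (by₁ (+ 2) q (solve (X ∷ []))) (by₀ (solve (Y ∷ []))) (by₂ Y 1ℤ q r (solve (X ∷ Y ∷ Z ∷ Z′ ∷ [])))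

    fixed-y : ∀ {X Y Z Z′} → Y ≈ 0ℤ → Z′ ≈ X * Y - Z → SignRel X Y Z X Y Z′
    fixed-y {X} {Y} {Z} {Z′} q r = signRel 1ℤ (- 1ℤ) ≈-refl ≈-refl
      (by₀ (solve (X ∷ []))) (by₁ (+ 2) q (solve (Y ∷ []))) (by₂ X 1ℤ q r (solve (X ∷ Y ∷ Z ∷ Z′ ∷ [])))

    fixed-z : ∀ {X Y Z Z′} → + 2 * Z - X * Y ≈ 0ℤ → Z′ ≈ X * Y - Z → SignRel X Y Z X Y Z′
    fixed-z {X} {Y} {Z} {Z′} q r = SignRel-refl ≈-refl ≈-refl
      (by₂ (- 1ℤ) 1ℤ q r (solve (X ∷ Y ∷ Z ∷ Z′ ∷ [])))

    quotient-≈ : ∀ {a} b → b ≉ 0ℤ → a * inv b * b ≈ a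
    quotient-≈ {a} b b≉0 = lem (inv b) (inv-inverse b≉0)
      where
      lem : ∀ i → b * i ≈ 1ℤ → a * i * b ≈ a
      lem i q = by₁ a q (solve (a ∷ b ∷ i ∷ []))

  sgn-m₃ : sgn (inducedGen p m₃) ≡ parity (card moveCycles)
  sgn-m₃ = Cycles.sgn-induced m₃-equivariant moveCycles
    (λ { ((hu , hv , hw) , s) → hu , hv , ℕ.≤-<-trans (proj₂ hw) h<p , s }) total apart
    where
    total : ∀ t → InY t → ¬ actGen p m₃ t ~ t →
      ∃ λ b → MoveCycle b × (CoordOf t b ⊎ CoordOf (actGen p m₃ t) b)
    total (x , y , z) (inY ((x<p , y<p , z<p) , s , _) _) moved = choose (sqrt {+ w} {C} (∣∣ₚ-sq C))
      where
      X = + x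
      Y′ = + y
      Z = + z
      z′ = proj₂ (proj₂ (actGen p m₃ (x , y , z)))
      z′≈ : + z′ ≈ X * Y′ - Z
      z′≈ = m₃-≈ {x} {y} z<p
      N = + 2 * Z - X * Y′
      C = N * inv (X * Y′)
      x≉0 : X ≉ 0ℤ
      x≉0 q = moved (SignRel-sym (fixed-x q z′≈))
      y≉0 : Y′ ≉ 0ℤ
      y≉0 q = moved (SignRel-sym (fixed-y q z′≈))
      n≉0 : N ≉ 0ℤ
      n≉0 q = moved (SignRel-sym (fixed-z q z′≈))
      C*XY≈N : C * (X * Y′) ≈ N
      C*XY≈N = quotient-≈ (X * Y′) (*-≉0 x≉0 y≉0)
      C≉0 : C ≉ 0ℤ
      C≉0 q = n≉0 (≈-trans (≈-sym C*XY≈N) (≈-trans (*-cong q ≈-refl) (by₀ refl)))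
      hu = halfQuotient (+ 2) X 2≉0 x≉0
      hv = halfQuotient (+ 2) Y′ 2≉0 y≉0
      u = proj₁ hu
      v = proj₁ hv
      w = ∣ C ∣ₚ
      uvw : Half u × Half v × Half w
      uvw = proj₁ (proj₂ hu) , proj₁ (proj₂ hv) , ∣∣ₚ-half C C≉0
      c : Coord X Y′ Z (+ u) (+ v) C
      c = coord (proj₂ (proj₂ hu)) (proj₂ (proj₂ hv)) C*XY≈N
      -- Taking w up to sign decides which member of the cycle has coordinates (u, v, w): the point
      -- itself if w is C, its image under m₃ if w is -C.
      choose : + w ≈ C ⊎ + w ≈ - C → ∃ λ b → MoveCycle b × (CoordOf (x , y , z) b ⊎ CoordOf (x , y , z′) b)
      choose (inj₁ q) = (u , v , w) , (uvw , Coord-sphere {X} {Y′} {Z} s c′) , inj₁ c′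
        where
        c′ : CoordOf (x , y , z) (u , v , w)
        c′ = Coord-W (≈-sym q) c
      choose (inj₂ q) = (u , v , w) , (uvw , Coord-sphere {X} {Y′} {+ z′} s′ c′) , inj₂ c′
        where
        c′ : CoordOf (x , y , z′) (u , v , w)
        c′ = Coord-~ (SignRel-refl ≈-refl ≈-refl z′≈) (Coord-W (≈-sym q) (Coord-m₃ c))
        s′ : OnSurface (x , y , z′)
        s′ = Equivariant.φ-surface m₃-equivariant (x , y , z) (x<p , y<p , z<p) s

    apart : ∀ t b b′ → Residues t → MoveCycle b → MoveCycle b′ → CoordOf t b → CoordOf (actGen p m₃ t) b′ → ⊥
    apart (x , y , z) (u , v , w) (u′ , v′ , w′) (_ , _ , z<p) ((_ , _ , hw) , _) ((_ , _ , hw′) , _) c c′ =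
      *-≉0 2≉0 (half-≉0 hw) (twice (+ w) (+ w′) w≈w′ -w≈w′)
      where
      -w≈w′ : - + w ≈ + w′
      -w≈w′ = proj₂ (proj₂ (Coord-functional (Coord-m₃ c)
        (Coord-~ (SignRel-refl ≈-refl ≈-refl (≈-sym (m₃-≈ {x} {y} z<p))) c′)))
      neg-sq : ∀ a → a * a ≡ - a * - a
      neg-sq = solve-∀
      w≈w′ : + w ≈ + w′
      w≈w′ = by₀ (cong +_ (sq-unique (proj₂ hw) (proj₂ hw′) (≈-trans (by₀ (neg-sq (+ w))) (sq-cong -w≈w′))))
      twice : ∀ a b → a ≈ b → - a ≈ b → + 2 * a ≈ 0ℤ
      twice a b q r = by₂ 1ℤ (- 1ℤ) q r (solve (a ∷ b ∷ []))

  MinusOneNonSquare : Set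
  MinusOneNonSquare = ∀ a → a * a ≉ - 1ℤ

  module _ (nonSquare : MinusOneNonSquare) where

    -- Otherwise b/a would be a square root of -1.
    sum-of-squares : ∀ {a b} → a * a + b * b ≈ 0ℤ → a ≈ 0ℤ
    sum-of-squares {a} {b} q = case a ≈? 0ℤ of λ
      { (yes a≈0) → a≈0
      ; (no a≉0)  → ⊥-elim (nonSquare (b * inv a) (lem (inv a) (inv-inverse a≉0))) }
      where
      lem : ∀ i → a * i ≈ 1ℤ → b * i * (b * i) ≈ - 1ℤ
      lem i r = by₂ (i * i) (- (a * i + 1ℤ)) q r (solve (a ∷ b ∷ i ∷ []))

    sum-of-squares′ : ∀ {a b} → a * a + b * b ≈ 0ℤ → a ≈ 0ℤ × b ≈ 0ℤ
    sum-of-squares′ {a} {b} q = sum-of-squares {a} {b} q ,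
      sum-of-squares {b} {a} (by₁ 1ℤ q (solve (a ∷ b ∷ [])))

    sgn-σ₁₂ : sgn (inducedGen p σ₁₂) ≡ parity (card swapCycles)
    sgn-σ₁₂ = Cycles.sgn-induced σ₁₂-equivariant swapCycles
      (λ { ((hu , hv , w<p) , _ , s) → hu , hv , w<p , s }) total apart
      where
      swapped : ∀ {X Y Z} → X * X ≈ Y * Y → SignRel Y X Z X Y Z
      swapped {X} {Y} {Z} q = [ same , opposite ]′ (sqrt {X} {Y} q)
        where
        same : X ≈ Y → SignRel Y X Z X Y Z
        same r = SignRel-refl r (≈-sym r) ≈-refl
        opposite : X ≈ - Y → SignRel Y X Z X Y Z
        opposite r = signRel (- 1ℤ) (- 1ℤ) ≈-refl ≈-refl
          (by₁ 1ℤ r (solve (X ∷ Y ∷ []))) (by₁ 1ℤ r (solve (X ∷ Y ∷ []))) (by₀ (solve (Z ∷ [])))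

      same-square : ∀ {X Y U V} → X ≉ 0ℤ → X * X * (U * U) ≈ + 4 → Y * Y * (V * V) ≈ + 4 → U * U ≈ V * V →
        X * X ≈ Y * Y
      same-square {X} {Y} {U} {V} x≉0 a b e = *-cancelˡ (U * U) U²≉0 scaled
        where
        U²≉0 : U * U ≉ 0ℤ
        U²≉0 q = 4≉0 (by₂ (- 1ℤ) (X * X) a q (solve (X ∷ U ∷ [])))
        scaled : U * U * (X * X) ≈ U * U * (Y * Y)
        scaled = by₃ 1ℤ (- 1ℤ) (- (Y * Y)) a b e (solve (X ∷ Y ∷ U ∷ V ∷ []))

      zero-x : ∀ {X Y Z} → X * X + Y * Y + Z * Z ≈ X * Y * Z → X ≈ 0ℤ → Y * Y + Z * Z ≈ 0ℤ
      zero-x {X} {Y} {Z} s q = by₂ 1ℤ (Y * Z - X) s q (solve (X ∷ Y ∷ Z ∷ []))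

      zero-y : ∀ {X Y Z} → X * X + Y * Y + Z * Z ≈ X * Y * Z → Y ≈ 0ℤ → X * X + Z * Z ≈ 0ℤ
      zero-y {X} {Y} {Z} s q = by₂ 1ℤ (X * Z - Y) s q (solve (X ∷ Y ∷ Z ∷ []))

      total : ∀ t → InY t → ¬ actGen p σ₁₂ t ~ t →
        ∃ λ b → SwapCycle b × (CoordOf t b ⊎ CoordOf (actGen p σ₁₂ t) b)
      total t@(x , y , z) (inY (r@(x<p , _) , s , t≢0) _) moved = choose (ℕ.<-cmp u v)
        where
        X = + x
        Y′ = + y
        Z = + z
        0<p : 0 ℕ.< p
        0<p = ℕ.≤-<-trans z≤n x<p
        x≉0 : X ≉ 0ℤ
        x≉0 q = let q′ , q″ = sum-of-squares′ {Y′} {Z} (zero-x {X} {Y′} {Z} s q)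
                in t≢0 (Residues-unique r (0<p , 0<p , 0<p) q q′ q″)
        y≉0 : Y′ ≉ 0ℤ
        y≉0 q = let q′ , q″ = sum-of-squares′ {X} {Z} (zero-y {X} {Y′} {Z} s q)
                in t≢0 (Residues-unique r (0<p , 0<p , 0<p) q′ q q″)
        N = + 2 * Z - X * Y′
        C = N * inv (X * Y′)
        hu = halfQuotient (+ 2) X 2≉0 x≉0
        hv = halfQuotient (+ 2) Y′ 2≉0 y≉0
        u = proj₁ hu
        v = proj₁ hv
        w = residue C
        xu = proj₂ (proj₂ hu)
        yv = proj₂ (proj₂ hv)
        c : CoordOf t (u , v , w)
        c = Coord-W (≈-sym (residue-≈ C)) (coord xu yv (quotient-≈ (X * Y′) (*-≉0 x≉0 y≉0)))
        sph : Sphere (+ u) (+ v) (+ w)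
        sph = Coord-sphere {X} {Y′} {Z} s c
        flip : ∀ {U V W} → Sphere U V W → Sphere V U W
        flip {U} {V} {W} (sphere e) = sphere (by₁ 1ℤ e (solve (U ∷ V ∷ W ∷ [])))
        choose : _ → ∃ λ b → SwapCycle b × (CoordOf t b ⊎ CoordOf (y , x , z) b)
        choose (tri< u<v _ _) = (u , v , w) , ((proj₁ (proj₂ hu) , proj₁ (proj₂ hv) , residue<p C) , u<v , sph) , inj₁ c
        choose (tri> _ _ v<u) = (v , u , w) , ((proj₁ (proj₂ hv) , proj₁ (proj₂ hu) , residue<p C) , v<u , flip sph) , inj₂ (Coord-σ₁₂ c)
        choose (tri≈ _ u≡v _) = ⊥-elim (moved (swapped {X} {Y′} {Z}
          (same-square {X} {Y′} {+ u} {+ v} x≉0 xu yv (by₀ (cong (λ u → + u * + u) u≡v)))))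

      apart : ∀ t b b′ → Residues t → SwapCycle b → SwapCycle b′ → CoordOf t b → CoordOf (actGen p σ₁₂ t) b′ → ⊥
      apart (x , y , z) (u , v , w) (u′ , v′ , w′) _ (((_ , u≤h) , (_ , v≤h) , _) , u<v , _)
            (((_ , u′≤h) , (_ , v′≤h) , _) , u′<v′ , _) c c′ =
        let v² , u² , _ = Coord-functional (Coord-σ₁₂ c) c′
        in ℕ.<-asym u<v (subst₂ ℕ._<_ (sym (sq-unique v≤h u′≤h v²)) (sym (sq-unique u≤h v′≤h u²)) u′<v′)

  -- Conics, and the reduction of m₃ to one of them

  record Conic (d U W : ℤ) : Set where
    constructor conic
    field equation : d * (U * U) + W * W ≈ 1ℤ

  ConicPoint : ℤ → ℕ × ℕ → Set
  ConicPoint d (u , w) = (Half u × Half w) × Conic d (+ u) (+ w)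

  conicPoints : ∀ d → Enum (ConicPoint d)
  conicPoints d = halves ⊗ halves ∩ (λ (u , w) → map′ conic Conic.equation (_ ≈? _))

  1≉0 : 1ℤ ≉ 0ℤ
  1≉0 q = 2≉0 (by₁ (+ 2) q refl)

  moveCycles-parity : parity (card moveCycles) ≡ parity (card (conicPoints (+ 2)))
  moveCycles-parity = trans (I.parity-card moveCycles diagonal) (cong parity bij)
    where
    flip : ∀ {U V W} → Sphere U V W → Sphere V U W
    flip {U} {V} {W} (sphere e) = sphere (by₁ 1ℤ e (solve (U ∷ V ∷ W ∷ [])))
    swap : Triple → Triple
    swap (u , v , w) = v , u , w
    maps : ∀ {t} → MoveCycle t → MoveCycle (swap t)
    maps ((hu , hv , hw) , s) = (hv , hu , hw) , flip s
    swap-fix : ∀ {t} → MoveCycle t → proj₁ (swap t) ≡ proj₁ t → swap t ≡ t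
    swap-fix _ refl = refl
    module I = Involution {P = MoveCycle} swap proj₁ (λ {t} → maps {t}) (λ _ → refl) (λ {t} → swap-fix {t})
    diagonal = I.fixedPoints moveCycles
    to : ∀ {U W} → Sphere U U W → Conic (+ 2) U W
    to {U} {W} (sphere e) = conic (by₁ 1ℤ e (solve (U ∷ W ∷ [])))
    from : ∀ {U W} → Conic (+ 2) U W → Sphere U U W
    from {U} {W} (conic e) = sphere (by₁ 1ℤ e (solve (U ∷ W ∷ [])))
    bij : card diagonal ≡ card (conicPoints (+ 2))
    bij = card-≡ diagonal (conicPoints (+ 2)) (λ (u , _ , w) b → (u , w) ≡ b)
      (λ { {u , _ , w} (((hu , _ , hw) , s) , refl) → (u , w) , ((hu , hw) , to s) , refl })
      (λ { {u , w} ((hu , hw) , c) → (u , u , w) , (((hu , hu , hw) , from c) , refl) , refl })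
      (λ { (_ , refl) (_ , refl) _ refl refl → refl })
      (λ { _ _ _ refl refl → refl })

  -- The case where -1 is a square

  module Square (i : ℤ) (i²≈-1 : i * i ≈ - 1ℤ) where

    i≉0 : i ≉ 0ℤ
    i≉0 q = 1≉0 (by₂ 1ℤ (- i) i²≈-1 q (solve (i ∷ [])))

    h-even : ∃ λ n → h ≡ n ℕ.+ n
    h-even = card asc , trans (sym (card-from1to h)) (trans (I.count halves asc fixed)
      (cong (card asc ℕ.+_) (trans (cong (card asc ℕ.+_) (card-empty fixed none)) (ℕ.+-identityʳ _))))
      where
      f : ℕ → ℕ
      f t = ∣ i * + t ∣ₚ
      f-half : ∀ {t} → Half t → Half (f t)
      f-half ht = ∣∣ₚ-half _ (*-≉0 i≉0 (half-≉0 ht))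
      twice : ∀ T T′ → T′ * T′ ≈ i * T * (i * T) → i * T′ * (i * T′) ≈ T * T
      twice T T′ q = by₂ (i * i) (T * T * (i * i - 1ℤ)) q i²≈-1 (solve (i ∷ T ∷ T′ ∷ []))
      module I = Involution {P = Half} f id f-half
        (λ {t} ht → sq-unique (proj₂ (f-half (f-half ht))) (proj₂ ht)
          (≈-trans (∣∣ₚ-sq (i * + f t)) (twice (+ t) (+ f t) (∣∣ₚ-sq (i * + t)))))
        (λ _ q → q)
      asc = I.ascents halves
      fixed = I.fixedPoints halves
      2T²≈0 : ∀ T → T * T ≈ i * T * (i * T) → + 2 * (T * T) ≈ 0ℤ
      2T²≈0 T q = by₂ 1ℤ (T * T) q i²≈-1 (solve (i ∷ T ∷ []))
      none : ∀ {t} → ¬ I.Fixed t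
      none {t} (ht , e) = *-≉0 2≉0 (*-≉0 (half-≉0 ht) (half-≉0 ht))
        (2T²≈0 (+ t) (≈-trans (by₀ (cong (λ t → + t * + t) (sym e))) (∣∣ₚ-sq (i * + t))))

    -- (2u², w²) ↦ (-2u²/w², 1/w²) preserves 2u² + w² = 1; at a fixed point w² = -1 and u² = 1.
    conic-odd : parity (card (conicPoints (+ 2))) ≡ 1ℙ
    conic-odd = trans (I.parity-card (conicPoints (+ 2)) fixed) (cong parity (card-singleton fixed witness fixed-unique))
      where
      P = ConicPoint (+ 2)
      f : ℕ × ℕ → ℕ × ℕ
      f (u , w) = ∣ i * + u * inv (+ w) ∣ₚ , ∣ inv (+ w) ∣ₚ

      -- Dividing 2U² + W² = 1 by W² and moving the first term across gives -2(U/W)² + (1/W)² = 1;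
      -- the factor `i` turns the minus sign into a square.
      maps-ℤ : ∀ U W J U′ W′ → Conic (+ 2) U W → W * J ≈ 1ℤ →
        U′ * U′ ≈ i * U * J * (i * U * J) → W′ * W′ ≈ J * J → Conic (+ 2) U′ W′
      maps-ℤ U W J U′ W′ (conic a) b c d = conic (≈-trans (+-cong (*-cong (≈-refl {+ 2}) c) d) eq)
        where
        eq : + 2 * (i * U * J * (i * U * J)) + J * J ≈ 1ℤ
        eq = by₃ (- (J * J)) (W * J + 1ℤ) (+ 2 * (U * U * (J * J))) a b i²≈-1 (solve (i ∷ U ∷ W ∷ J ∷ []))

      invol-W : ∀ W J W′ K → W * J ≈ 1ℤ → W′ * W′ ≈ J * J → W′ * K ≈ 1ℤ → K * K ≈ W * W
      invol-W W J W′ K b d e = by₃ (- (K * K * (W * J + 1ℤ))) (- (K * K * (W * W))) (W * W * (W′ * K + 1ℤ)) b d e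
        (solve (W ∷ J ∷ W′ ∷ K ∷ []))

      invol-U : ∀ U W J U′ K → W * J ≈ 1ℤ → U′ * U′ ≈ i * U * J * (i * U * J) → K * K ≈ W * W →
        i * U′ * K * (i * U′ * K) ≈ U * U
      invol-U U W J U′ K b c k = by₄ (i * i * (K * K)) (i * i * (i * i) * (U * U * (J * J)))
        (i * i * (i * i) * (U * U) * (W * J + 1ℤ)) (U * U * (i * i - 1ℤ)) c k b i²≈-1
        (solve (i ∷ U ∷ W ∷ J ∷ U′ ∷ K ∷ []))

      inverse : ∀ {w} → Half w → + w * inv (+ w) ≈ 1ℤ
      inverse hw = inv-inverse (half-≉0 hw)

      inv-≉0 : ∀ {w} → Half w → inv (+ w) ≉ 0ℤ
      inv-≉0 {w} hw q = 1≉0 (≈-trans (≈-sym (inverse hw)) (lem (+ w) (inv (+ w)) q))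
        where
        lem : ∀ W J → J ≈ 0ℤ → W * J ≈ 0ℤ
        lem W J q = by₁ W q (solve (W ∷ J ∷ []))

      maps : ∀ {a} → P a → P (f a)
      maps {u , w} ((hu , hw) , c) =
        (∣∣ₚ-half _ (*-≉0 (*-≉0 i≉0 (half-≉0 hu)) (inv-≉0 hw)) , ∣∣ₚ-half _ (inv-≉0 hw)) ,
        maps-ℤ (+ u) (+ w) (inv (+ w)) _ _ c (inverse hw) (∣∣ₚ-sq (i * + u * inv (+ w))) (∣∣ₚ-sq (inv (+ w)))

      invol : ∀ {a} → P a → f (f a) ≡ a
      invol {u , w} q@((hu , hw) , c) =
        cong₂ _,_ (sq-unique (∣∣ₚ-≤h (i * + u′ * K)) (proj₂ hu) (≈-trans (∣∣ₚ-sq (i * + u′ * K)) U²))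
                  (sq-unique (∣∣ₚ-≤h K) (proj₂ hw) (≈-trans (∣∣ₚ-sq K) K²))
        where
        u′ = proj₁ (f (u , w))
        w′ = proj₂ (f (u , w))
        J = inv (+ w)
        K = inv (+ w′)
        hw′ : Half w′
        hw′ = proj₂ (proj₁ (maps {u , w} q))
        K² : K * K ≈ + w * + w
        K² = invol-W (+ w) J (+ w′) K (inverse hw) (∣∣ₚ-sq J) (inverse hw′)
        U² : i * + u′ * K * (i * + u′ * K) ≈ + u * + u
        U² = invol-U (+ u) (+ w) J (+ u′) K (inverse hw) (∣∣ₚ-sq (i * + u * J)) K²

      -- A fixed point has W⁴ = 1, and W² = 1 would force U = 0 on the conic.
      fixed-W : ∀ U W J → Conic (+ 2) U W → U ≉ 0ℤ → W * J ≈ 1ℤ → J * J ≈ W * W → W * W ≈ - 1ℤ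
      fixed-W U W J (conic a) u≉0 b q =
        [ (λ r → ⊥-elim (*-≉0 2≉0 (*-≉0 u≉0 u≉0) (absurd r))) , id ]′ (sqrt {W * W} {1ℤ} W⁴)
        where
        W⁴ : W * W * (W * W) ≈ 1ℤ * 1ℤ
        W⁴ = by₂ (- (W * W)) (W * J + 1ℤ) q b (solve (W ∷ J ∷ []))
        absurd : W * W ≈ 1ℤ → + 2 * (U * U) ≈ 0ℤ
        absurd r = by₂ 1ℤ (- 1ℤ) a r (solve (U ∷ W ∷ []))

      fixed-U : ∀ U W J → J * J ≈ W * W → W * W ≈ - 1ℤ → i * U * J * (i * U * J) ≈ U * U
      fixed-U U W J q r = by₃ (i * i * (U * U)) (i * i * (U * U)) (- (U * U)) q r i²≈-1 (solve (i ∷ U ∷ W ∷ J ∷ []))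

      w²≈-1 : ∀ {u w} → P (u , w) → ∣ inv (+ w) ∣ₚ ≡ w → inv (+ w) * inv (+ w) ≈ + w * + w × + w * + w ≈ - 1ℤ
      w²≈-1 {u} {w} ((hu , hw) , c) e = J² , fixed-W (+ u) (+ w) (inv (+ w)) c (half-≉0 hu) (inverse hw) J²
        where
        J² : inv (+ w) * inv (+ w) ≈ + w * + w
        J² = ≈-trans (≈-sym (∣∣ₚ-sq (inv (+ w)))) (by₀ (cong (λ w → + w * + w) e))

      -- The second coordinate suffices as a label: if it is fixed then W² = -1, so the multiplier
      -- i/W of the first coordinate has square 1.
      k-fix : ∀ {a} → P a → proj₂ (f a) ≡ proj₂ a → f a ≡ a
      k-fix {u , w} q@((hu , _) , _) e = let J² , W² = w²≈-1 {u} {w} q e in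
        cong₂ _,_ (sq-unique (∣∣ₚ-≤h (i * + u * inv (+ w))) (proj₂ hu)
          (≈-trans (∣∣ₚ-sq (i * + u * inv (+ w))) (fixed-U (+ u) (+ w) (inv (+ w)) J² W²))) e

      module I = Involution {P = P} f proj₂ (λ {a} → maps {a}) (λ {a} → invol {a}) (λ {a} → k-fix {a})
      fixed = I.fixedPoints (conicPoints (+ 2))

      fixed-unique : ∀ {a b} → I.Fixed a → I.Fixed b → a ≡ b
      fixed-unique {u , w} {u′ , w′} (q@((hu , hw) , conic c) , e) (q′@((hu′ , hw′) , conic c′) , e′) =
        cong₂ _,_ (sq-unique (proj₂ hu) (proj₂ hu′) (*-cancelˡ (+ 2) 2≉0 (same-U (+ u) (+ w) (+ u′) (+ w′) c c′ W² W²′)))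
                  (sq-unique (proj₂ hw) (proj₂ hw′) (≈-trans W² (≈-sym W²′)))
        where
        W² = proj₂ (w²≈-1 {u} {w} q (cong proj₂ e))
        W²′ = proj₂ (w²≈-1 {u′} {w′} q′ (cong proj₂ e′))
        same-U : ∀ U W U′ W′ → + 2 * (U * U) + W * W ≈ 1ℤ → + 2 * (U′ * U′) + W′ * W′ ≈ 1ℤ →
          W * W ≈ - 1ℤ → W′ * W′ ≈ - 1ℤ → + 2 * (U * U) ≈ + 2 * (U′ * U′)
        same-U U W U′ W′ a b c d = by₄ 1ℤ (- 1ℤ) (- 1ℤ) 1ℤ a b c d (solve (U ∷ W ∷ U′ ∷ W′ ∷ []))

      witness : ∃ I.Fixed
      witness = (1 , w) , Pw , k-fix {1 , w} Pw (sq-unique (∣∣ₚ-≤h (inv (+ w))) (proj₂ hw) (≈-trans (∣∣ₚ-sq (inv (+ w))) (lem (+ w) (inv (+ w)) W² (inverse hw))))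
        where
        w = ∣ i ∣ₚ
        hw : Half w
        hw = ∣∣ₚ-half i i≉0
        W² : + w * + w ≈ - 1ℤ
        W² = ≈-trans (∣∣ₚ-sq i) i²≈-1
        lem : ∀ W J → W * W ≈ - 1ℤ → W * J ≈ 1ℤ → J * J ≈ W * W
        lem W J q r = by₂ (J * J - 1ℤ) (- (W * J + 1ℤ)) q r (solve (W ∷ J ∷ []))
        eqn : ∀ W → W * W ≈ - 1ℤ → Conic (+ 2) 1ℤ W
        eqn W q = conic (by₁ 1ℤ q (solve (W ∷ [])))
        Pw : P (1 , w)
        Pw = ((s≤s z≤n , ℕ.≤-trans (proj₁ hw) (proj₂ hw)) , hw) , eqn (+ w) W²

  -- The case where -1 is not a square: parametrised conics

  module _ (nonSquare : MinusOneNonSquare) where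

    -- Equal fourth powers give s² = t² or s² = -t², and the latter is a vanishing sum of two
    -- squares.
    fourthPower-injective : ∀ {s t} → Half s → Half t → + s * + s * (+ s * + s) ≈ + t * + t * (+ t * + t) → s ≡ t
    fourthPower-injective {s} {t} hs ht q = [ sq-unique (proj₂ hs) (proj₂ ht) , opposite ]′ (sqrt {+ s * + s} {+ t * + t} q)
      where
      lem : ∀ S T → S * S ≈ - (T * T) → S * S + T * T ≈ 0ℤ
      lem S T r = by₁ 1ℤ r (solve (S ∷ T ∷ []))
      opposite : + s * + s ≈ - (+ t * + t) → s ≡ t
      opposite r = ⊥-elim (half-≉0 hs (sum-of-squares nonSquare {+ s} {+ t} (lem (+ s) (+ t) r)))

    -- Squaring permutes the nonzero residues up to sign, so exactly one of ±d is a square.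
    fourthRoot : ∀ d → d ≉ 0ℤ → ∃ λ t → Half t × + t * + t * (+ t * + t) ≈ d * d
    fourthRoot d d≉0 =
      let t , ht , e = injective⇒surjective ℕ._≟_ halves (λ t → ∣ + t * + t ∣ₚ)
            (λ {t} ht → ∣∣ₚ-half (+ t * + t) (*-≉0 (half-≉0 ht) (half-≉0 ht)))
            (λ {s} {t} hs ht e → fourthPower-injective hs ht
              (≈-trans (≈-sym (∣∣ₚ-sq (+ s * + s))) (≈-trans (by₀ (cong sq e)) (∣∣ₚ-sq (+ t * + t)))))
            (∣∣ₚ-half d d≉0)
      in t , ht , ≈-trans (≈-sym (∣∣ₚ-sq (+ t * + t))) (≈-trans (by₀ (cong sq e)) (∣∣ₚ-sq d))
      where
      sq : ℕ → ℤ
      sq t = + t * + t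

    module Parametrisation (d : ℤ) (d≉0 : d ≉ 0ℤ) where

      -- Here t² = d or t² = -d: in the parametrisation (2t/(d + t²), (d - t²)/(d + t²)) these are
      -- the t for which W or the denominator vanishes. They are also the fixed points of t ↦ d/t up
      -- to sign.
      Root : ℕ → Set
      Root t = + t * + t * (+ t * + t) ≈ d * d

      root? : ∀ t → Dec (Root t)
      root? t = _ ≈? _

      Parameter : ℕ → Set
      Parameter t = Half t × ¬ Root t

      parameters : Enum Parameter
      parameters = halves ∩ (¬? ∘ root?)

      card-parameters : h ≡ suc (card parameters)
      card-parameters = trans (sym (card-from1to h)) (trans
        (card-⊎ halves (halves ∩ root?) parameters
          (λ {t} ht → case root? t of λ { (yes r) → inj₁ (ht , r) ; (no r) → inj₂ (ht , r) })
          proj₁ proj₁ (λ (_ , r) (_ , ¬r) → ¬r r))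
        (cong (ℕ._+ card parameters) (card-singleton (halves ∩ root?) (fourthRoot d d≉0)
          (λ { (hs , r) (ht , r′) → fourthPower-injective hs ht (≈-trans r (≈-sym r′)) }))))

      -- Replacing t by d/t keeps U and negates W, and replacing t by -t negates U. Points up to
      -- signs therefore correspond to 2-cycles of `f` on parameters up to sign.
      f : ℕ → ℕ
      f t = ∣ d * inv (+ t) ∣ₚ

      f-eq : ∀ {t} → Half t → + t * + t * (+ f t * + f t) ≈ d * d
      f-eq {t} ht = lem (+ t) (inv (+ t)) (+ f t) (inv-inverse (half-≉0 ht)) (∣∣ₚ-sq (d * inv (+ t)))
        where
        lem : ∀ T I T′ → T * I ≈ 1ℤ → T′ * T′ ≈ d * I * (d * I) → T * T * (T′ * T′) ≈ d * d
        lem T I T′ q r = by₂ (d * d * (T * I + 1ℤ)) (T * T) q r (solve (d ∷ T ∷ I ∷ T′ ∷ []))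

      f-half : ∀ {t} → Half t → Half (f t)
      f-half {t} ht = ∣∣ₚ-half (d * inv (+ t)) λ q → *-≉0 d≉0 d≉0
        (≈-trans (≈-sym (f-eq ht)) (lem (+ t) (+ f t) (d * inv (+ t)) (∣∣ₚ-sq (d * inv (+ t))) q))
        where
        lem : ∀ T T′ e → T′ * T′ ≈ e * e → e ≈ 0ℤ → T * T * (T′ * T′) ≈ 0ℤ
        lem T T′ e q r = by₂ (T * T) (T * T * e) q r (solve (T ∷ T′ ∷ e ∷ []))

      f-unique : ∀ {t s} → Half t → s ℕ.≤ h → + t * + t * (+ s * + s) ≈ d * d → s ≡ f t
      f-unique {t} {s} ht s≤h q = sq-unique s≤h (proj₂ (f-half ht))
        (*-cancelˡ (+ t * + t) (*-≉0 (half-≉0 ht) (half-≉0 ht)) (≈-trans q (≈-sym (f-eq ht))))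

      f-maps : ∀ {t} → Parameter t → Parameter (f t)
      f-maps {t} (ht , ¬r) = f-half ht , λ r → ¬r
        (*-cancelˡ (d * d) (*-≉0 d≉0 d≉0) (lem (+ t * + t) (+ f t * + f t) (f-eq ht) r))
        where
        lem : ∀ S S′ → S * S′ ≈ d * d → S′ * S′ ≈ d * d → d * d * (S * S) ≈ d * d * (d * d)
        lem S S′ q r = by₂ (S * S′ + d * d) (- (S * S)) q r (solve (d ∷ S ∷ S′ ∷ []))

      f-invol : ∀ {t} → Parameter t → f (f t) ≡ t
      f-invol {t} (ht , _) = sym (f-unique (f-half ht) (proj₂ ht) (≈-trans (by₀ (comm (+ f t * + f t) (+ t * + t))) (f-eq ht)))
        where
        comm : ∀ a b → a * b ≡ b * a
        comm = solve-∀

      f-no-fixed : ∀ {t} → Parameter t → f t ≢ t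
      f-no-fixed {t} (ht , ¬r) e = ¬r (subst (λ s → + t * + t * (+ s * + s) ≈ d * d) e (f-eq ht))

      module I = Involution {P = Parameter} f id f-maps f-invol (λ _ q → q)

      -- With S = t²: the point (U, W) = (2t/(d + S), (d - S)/(d + S)) up to signs.
      record OnLine (S U W : ℤ) : Set where
        constructor onLine
        field
          u-eq : (d + S) * (d + S) * (U * U) ≈ + 4 * S
          w-eq : (d + S) * (d + S) * (W * W) ≈ (d - S) * (d - S)

      R : ℕ → ℕ × ℕ → Set
      R t (u , w) = OnLine (+ t * + t) (+ u) (+ w)

      R-f : ∀ S S′ U W → S ≉ 0ℤ → S * S′ ≈ d * d → OnLine S U W → OnLine S′ U W
      R-f S S′ U W s≉0 g (onLine a b) = onLine (cancel ua) (cancel wb)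
        where
        cancel : ∀ {x y} → S * S * x ≈ S * S * y → x ≈ y
        cancel = *-cancelˡ (S * S) (*-≉0 s≉0 s≉0)
        ua : S * S * ((d + S′) * (d + S′) * (U * U)) ≈ S * S * (+ 4 * S′)
        ua = by₂ (U * U * (+ 2 * (d * S) + S * S′ + d * d) - + 4 * S) (d * d) g a (solve (d ∷ S ∷ S′ ∷ U ∷ []))
        wb : S * S * ((d + S′) * (d + S′) * (W * W)) ≈ S * S * ((d - S′) * (d - S′))
        wb = by₂ (W * W * (+ 2 * (d * S) + S * S′ + d * d) + (+ 2 * (d * S) - S * S′ - d * d)) (d * d) g b
          (solve (d ∷ S ∷ S′ ∷ W ∷ []))

      module _ {t} (par : Parameter t) where
        private
          S = + t * + t
          factor : ∀ S → (d + S) * (d - S) ≡ d * d - S * S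
          factor S = solve (d ∷ S ∷ [])
          root : ∀ S → d * d - S * S ≈ 0ℤ → S * S ≈ d * d
          root S q = by₁ (- 1ℤ) q (solve (d ∷ S ∷ []))

        nonzero : (d + S) * (d - S) ≉ 0ℤ
        nonzero q = proj₂ par (root S (≈-trans (by₀ (sym (factor S))) q))

        d+S≉0 : d + S ≉ 0ℤ
        d+S≉0 q = nonzero (lem (d + S) (d - S) q)
          where
          lem : ∀ a b → a ≈ 0ℤ → a * b ≈ 0ℤ
          lem a b q = by₁ b q (solve (a ∷ b ∷ []))

        d-S≉0 : d - S ≉ 0ℤ
        d-S≉0 q = nonzero (lem (d + S) (d - S) q)
          where
          lem : ∀ a b → b ≈ 0ℤ → a * b ≈ 0ℤ
          lem a b q = by₁ a q (solve (a ∷ b ∷ []))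

      totˡ : ∀ {t} → Parameter t → f t ≢ t → ∃ λ b → ConicPoint d b × R t b
      totˡ {t} par@(ht , _) _ =
        let u , hu , a = halfQuotient (+ 2 * + t) (d + + t * + t) (*-≉0 2≉0 (half-≉0 ht)) (d+S≉0 par)
            w , hw , b = halfQuotient (d - + t * + t) (d + + t * + t) (d-S≉0 par) (d+S≉0 par)
            a′ = ≈-trans a (by₀ (double (+ t)))
        in (u , w) , ((hu , hw) , onConic (+ t * + t) (+ u) (+ w) (d+S≉0 par) a′ b) , onLine a′ b
        where
        double : ∀ T → + 2 * T * (+ 2 * T) ≡ + 4 * (T * T)
        double = solve-∀
        onConic : ∀ S U W → d + S ≉ 0ℤ → (d + S) * (d + S) * (U * U) ≈ + 4 * S →
          (d + S) * (d + S) * (W * W) ≈ (d - S) * (d - S) → Conic d U W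
        onConic S U W ne a b = conic (*-cancelˡ ((d + S) * (d + S)) (*-≉0 ne ne) scaled)
          where
          scaled : (d + S) * (d + S) * (d * (U * U) + W * W) ≈ (d + S) * (d + S) * 1ℤ
          scaled = by₂ d 1ℤ a b (solve (d ∷ S ∷ U ∷ W ∷ []))

      module _ (U W : ℤ) (u≉0 : U ≉ 0ℤ) (c : d * (U * U) + W * W ≈ 1ℤ) where

        1-W≉0 : 1ℤ - W ≉ 0ℤ
        1-W≉0 q = *-≉0 d≉0 (*-≉0 u≉0 u≉0) dU²≈0
          where
          dU²≈0 : d * (U * U) ≈ 0ℤ
          dU²≈0 = by₂ 1ℤ (1ℤ + W) c q (solve (d ∷ U ∷ W ∷ []))

        module _ (S : ℤ) (s : U * U * S ≈ (1ℤ - W) * (1ℤ - W)) where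

          -- Both dU² = (1 - W)(1 + W) and SU² = (1 - W)² contain the factor 1 - W. The product of
          -- `sum` and `diff` is 4W(1 - W)², which is why W ≠ 0 excludes a root.
          sum : (d + S) * (U * U) ≈ + 2 * (1ℤ - W)
          sum = by₂ 1ℤ 1ℤ c s (solve (d ∷ U ∷ W ∷ S ∷ []))

          diff : (d - S) * (U * U) ≈ + 2 * W * (1ℤ - W)
          diff = by₂ 1ℤ (- 1ℤ) c s (solve (d ∷ U ∷ W ∷ S ∷ []))

          not-root : W ≉ 0ℤ → ¬ S * S ≈ d * d
          not-root w≉0 q = *-≉0 (*-≉0 2≉0 1-W≉0) (*-≉0 (*-≉0 2≉0 w≉0) 1-W≉0)
            (≈-trans (≈-sym (*-cong sum diff)) vanish)
            where
            vanish : (d + S) * (U * U) * ((d - S) * (U * U)) ≈ 0ℤ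
            vanish = by₁ (- (U * U * (U * U))) q (solve (d ∷ U ∷ S ∷ []))

          line : OnLine S U W
          line = onLine (*-cancelˡ (U * U) (*-≉0 u≉0 u≉0) ua)
            (*-cancelˡ (U * U * (U * U)) (*-≉0 (*-≉0 u≉0 u≉0) (*-≉0 u≉0 u≉0)) wb)
            where
            ua : U * U * ((d + S) * (d + S) * (U * U)) ≈ U * U * (+ 4 * S)
            ua = by₂ ((d + S) * (U * U) + + 2 * (1ℤ - W)) (- + 4) sum s (solve (d ∷ U ∷ W ∷ S ∷ []))
            wb : U * U * (U * U) * ((d + S) * (d + S) * (W * W)) ≈ U * U * (U * U) * ((d - S) * (d - S))
            wb = by₂ (W * W * ((d + S) * (U * U) + + 2 * (1ℤ - W))) (- ((d - S) * (U * U) + + 2 * W * (1ℤ - W)))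
              sum diff (solve (d ∷ U ∷ W ∷ S ∷ []))

      totʳ : ∀ {b} → ConicPoint d b → ∃ λ t → Parameter t × f t ≢ t × R t b
      totʳ {u , w} ((hu , hw) , conic c) = t , par , f-no-fixed par , line U W u≉0 c S s
        where
        U = + u
        W = + w
        u≉0 : U ≉ 0ℤ
        u≉0 = half-≉0 hu
        -- Up to sign, t is the slope of the line from (U, W) to the base point (0, 1) of the
        -- parametrisation.
        quotient = halfQuotient (1ℤ - W) U (1-W≉0 U W u≉0 c) u≉0
        t = proj₁ quotient
        S = + t * + t
        s : U * U * S ≈ (1ℤ - W) * (1ℤ - W)
        s = proj₂ (proj₂ quotient)
        par : Parameter t
        par = proj₁ (proj₂ quotient) , not-root U W u≉0 c S s (half-≉0 hw)

      -- W² determines (d - S)/(d + S) up to sign. The same sign gives S′ = S, the opposite sign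
      -- gives SS′ = d², that is t′ = d/t up to sign.
      injˡ : ∀ {t t′ b} → Parameter t → Parameter t′ → ConicPoint d b → R t b → R t′ b → t′ ≡ t ⊎ t′ ≡ f t
      injˡ {t} {t′} {u , w} (ht , _) (ht′ , _) _ (onLine _ b) (onLine _ b′) =
        Sum.map (λ q → sq-unique (proj₂ ht′) (proj₂ ht) (*-cancelˡ (+ 2 * d) (*-≉0 2≉0 d≉0) (same (+ t * + t) (+ t′ * + t′) q)))
                (λ q → f-unique ht (proj₂ ht′) (*-cancelˡ (+ 2) 2≉0 (opposite (+ t * + t) (+ t′ * + t′) q)))
                (sqrt (cross (+ t * + t) (+ t′ * + t′) (+ w) b b′))
        where
        cross : ∀ S S′ W → (d + S) * (d + S) * (W * W) ≈ (d - S) * (d - S) →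
          (d + S′) * (d + S′) * (W * W) ≈ (d - S′) * (d - S′) →
          (d - S) * (d + S′) * ((d - S) * (d + S′)) ≈ (d - S′) * (d + S) * ((d - S′) * (d + S))
        cross S S′ W b b′ = by₂ (- ((d + S′) * (d + S′))) ((d + S) * (d + S)) b b′ (solve (d ∷ S ∷ S′ ∷ W ∷ []))
        same : ∀ S S′ → (d - S) * (d + S′) ≈ (d - S′) * (d + S) → + 2 * d * S′ ≈ + 2 * d * S
        same S S′ q = by₁ 1ℤ q (solve (d ∷ S ∷ S′ ∷ []))
        opposite : ∀ S S′ → (d - S) * (d + S′) ≈ - ((d - S′) * (d + S)) → + 2 * (S * S′) ≈ + 2 * (d * d)
        opposite S S′ q = by₁ (- 1ℤ) q (solve (d ∷ S ∷ S′ ∷ []))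

      injʳ : ∀ {t b b′} → Parameter t → ConicPoint d b → ConicPoint d b′ → R t b → R t b′ → b ≡ b′
      injʳ par (((_ , u≤h) , (_ , w≤h)) , _) (((_ , u′≤h) , (_ , w′≤h)) , _) (onLine a b) (onLine a′ b′) =
        cong₂ _,_ (sq-unique u≤h u′≤h (cancel (≈-trans a (≈-sym a′)))) (sq-unique w≤h w′≤h (cancel (≈-trans b (≈-sym b′))))
        where
        cancel : ∀ {x y} → _ → x ≈ y
        cancel = *-cancelˡ _ (*-≉0 (d+S≉0 par) (d+S≉0 par))

      -- Among the h parameters up to sign, 1 is the unique root, and each point of the conic
      -- accounts for the two parameters t and `f t`.
      card-conic : h ≡ suc (card (conicPoints d) ℕ.+ card (conicPoints d))
      card-conic = begin
        h                                    ≡⟨ card-parameters ⟩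
        suc (card parameters)                ≡⟨ cong suc (I.count parameters asc (I.fixedPoints parameters)) ⟩
        suc (card asc ℕ.+ (card asc ℕ.+ card (I.fixedPoints parameters)))
          ≡⟨ cong (λ n → suc (card asc ℕ.+ (card asc ℕ.+ n))) (card-empty (I.fixedPoints parameters) (λ (q , e) → f-no-fixed q e)) ⟩
        suc (card asc ℕ.+ (card asc ℕ.+ 0))  ≡⟨ cong (λ n → suc (card asc ℕ.+ n)) (ℕ.+-identityʳ (card asc)) ⟩
        suc (card asc ℕ.+ card asc)          ≡⟨ cong (λ n → suc (n ℕ.+ n)) asc≡ ⟩
        suc (card (conicPoints d) ℕ.+ card (conicPoints d)) ∎
        where
        open ≡-Reasoning
        asc = I.ascents parameters
        asc≡ : card asc ≡ card (conicPoints d)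
        asc≡ = I.card-ascents asc (conicPoints d) R
          (λ { {t} {u , w} (ht , _) _ → R-f (+ t * + t) (+ f t * + f t) (+ u) (+ w) (*-≉0 (half-≉0 ht) (half-≉0 ht)) (f-eq ht) })
          totˡ (λ {b} → totʳ {b}) (λ {t} {t′} {b} → injˡ {t} {t′} {b}) injʳ

  -- The circle, and the reduction of σ₁₂ to it

  Conic-flip : ∀ {U V} → Conic 1ℤ U V → Conic 1ℤ V U
  Conic-flip {U} {V} (conic e) = conic (by₁ 1ℤ e (solve (U ∷ V ∷ [])))

  swap : ℕ × ℕ → ℕ × ℕ
  swap (u , v) = v , u

  swap-maps : ∀ {b} → ConicPoint 1ℤ b → ConicPoint 1ℤ (swap b)
  swap-maps ((hu , hv) , c) = (hv , hu) , Conic-flip c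

  swap-fix : ∀ {b} → ConicPoint 1ℤ b → proj₁ (swap b) ≡ proj₁ b → swap b ≡ b
  swap-fix _ refl = refl

  module Circle = Involution {P = ConicPoint 1ℤ} swap proj₁
    (λ {b} → swap-maps {b}) (λ _ → refl) (λ {b} → swap-fix {b})

  circle = conicPoints 1ℤ
  arcs = Circle.ascents circle
  diagonal = Circle.fixedPoints circle

  diagonal-≤1 : card diagonal ℕ.≤ 1
  diagonal-≤1 = card-≤1 diagonal
    (λ { {u , _} {u′ , _} ((((_ , u≤h) , _) , conic c) , refl) ((((_ , u′≤h) , _) , conic c′) , refl) →
      cong (λ u → u , u) (sq-unique u≤h u′≤h (*-cancelˡ (+ 2) 2≉0 (lem (+ u) (+ u′) c c′))) })
    where
    lem : ∀ U U′ → 1ℤ * (U * U) + U * U ≈ 1ℤ → 1ℤ * (U′ * U′) + U′ * U′ ≈ 1ℤ → + 2 * (U * U) ≈ + 2 * (U′ * U′)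
    lem U U′ a b = by₂ 1ℤ (- 1ℤ) a b (solve (U ∷ U′ ∷ []))

  swapCycles-parity : parity (card swapCycles) ≡ parity (card arcs)
  swapCycles-parity = trans (I.parity-card swapCycles fixed) (cong parity bij)
    where
    negW : ∀ {U V W W′} → W′ ≈ - W → Sphere U V W → Sphere U V W′
    negW {U} {V} {W} {W′} q (sphere e) = sphere (by₂ (W′ - W) 1ℤ q e (solve (U ∷ V ∷ W ∷ W′ ∷ [])))
    twice : ∀ {A B C} → B ≈ - A → C ≈ - B → C ≈ A
    twice {A} {B} {C} q r = by₂ (- 1ℤ) 1ℤ q r (solve (A ∷ B ∷ C ∷ []))
    reflect : Triple → Triple
    reflect (u , v , w) = u , v , neg p w
    third : Triple → ℕ
    third (_ , _ , w) = w
    maps : ∀ {t} → SwapCycle t → SwapCycle (reflect t)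
    maps {_ , _ , w} ((hu , hv , w<p) , u<v , s) = (hu , hv , neg<p w) , u<v , negW (neg-≈ w<p) s
    invol : ∀ {t} → SwapCycle t → reflect (reflect t) ≡ t
    invol {u , v , w} ((_ , _ , w<p) , _) =
      cong (λ w → u , v , w) (residue-unique (neg<p (neg p w)) w<p (twice (neg-≈ w<p) (neg-≈ (neg<p w))))
    third-fix : ∀ {t} → SwapCycle t → third (reflect t) ≡ third t → reflect t ≡ t
    third-fix {u , v , _} _ e = cong (λ w → u , v , w) e
    module I = Involution {P = SwapCycle} reflect third
      (λ {t} → maps {t}) (λ {t} → invol {t}) (λ {t} → third-fix {t})
    fixed = I.fixedPoints swapCycles
    0<p : 0 ℕ.< p
    0<p = ℕ.≤-<-trans z≤n 2<p
    zero-W : ∀ {W W′} → W′ ≈ - W → W′ ≈ W → + 2 * W ≈ + 2 * 0ℤ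
    zero-W {W} {W′} q r = by₂ 1ℤ (- 1ℤ) q r (solve (W ∷ W′ ∷ []))
    w≡0 : ∀ {u v w} → I.Fixed (u , v , w) → w ≡ 0
    w≡0 (((_ , _ , w<p) , _) , e) = residue-unique w<p 0<p (*-cancelˡ (+ 2) 2≉0
      (zero-W (neg-≈ w<p) (by₀ (cong (λ t → + proj₂ (proj₂ t)) e))))
    to : ∀ {U V} → Sphere U V 0ℤ → Conic 1ℤ U V
    to {U} {V} (sphere e) = conic (by₁ 1ℤ e (solve (U ∷ V ∷ [])))
    from : ∀ {U V} → Conic 1ℤ U V → Sphere U V 0ℤ
    from {U} {V} (conic e) = sphere (by₁ 1ℤ e (solve (U ∷ V ∷ [])))
    bij : card fixed ≡ card arcs
    bij = card-≡ fixed arcs (λ (u , v , _) b → (u , v) ≡ b)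
      (λ { {u , v , w} q@(((hu , hv , w<p) , u<v , s) , _) →
           (u , v) , (((hu , hv) , to (subst (λ w → Sphere (+ u) (+ v) (+ w)) (w≡0 q) s)) , u<v) , refl })
      (λ { {u , v} (((hu , hv) , c) , u<v) →
           (u , v , 0) , (((hu , hv , 0<p) , u<v , from c) ,
             cong (λ w → u , v , w) (residue-unique (neg<p 0) 0<p (neg-≈ 0<p))) , refl })
      (λ { {u , v , w} {u′ , v′ , w′} q q′ _ refl refl → cong (λ w → u , v , w) (trans (w≡0 q) (sym (w≡0 q′))) })
      (λ { _ _ _ refl refl → refl })

  sgn-m₃-conic : sgn (inducedGen p m₃) ≡ parity (card (conicPoints (+ 2)))
  sgn-m₃-conic = trans sgn-m₃ moveCycles-parity

  -- The equivalence in the two cases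

  module SquareCase (i : ℤ) (i²≈-1 : i * i ≈ - 1ℤ) where

    open Square i i²≈-1

    1≢0 : 1ℙ ≢ 0ℙ
    1≢0 ()

    to : HinAlt p → p ℕ.% 16 ≡ 3
    to H = ⊥-elim (1≢0 (trans (sym (trans sgn-m₃-conic conic-odd)) (HinAlt⇒ H r₃)))

    from : p ℕ.% 16 ≡ 3 → HinAlt p
    from e = ⊥-elim (1≢0 (trans (sym odd) even))
      where
      q = proj₁ (%16⇒ p h p≡2h+1 e)
      odd : parity h ≡ 1ℙ
      odd = trans (cong parity (proj₂ (%16⇒ p h p≡2h+1 e)))
        (parity-suc-double ((q ℕ.+ q) ℕ.+ (q ℕ.+ q)))
      even : parity h ≡ 0ℙ
      even = trans (cong parity (proj₂ h-even)) (parity-double (proj₁ h-even))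

  module NonSquareCase (nonSquare : MinusOneNonSquare) where

    private
      c = card (conicPoints (+ 2))
      c′ = card circle
      b = card arcs
      e = card diagonal

      h≡ : h ≡ suc (c ℕ.+ c)
      h≡ = Parametrisation.card-conic nonSquare (+ 2) 2≉0
      h≡′ : h ≡ suc (c′ ℕ.+ c′)
      h≡′ = Parametrisation.card-conic nonSquare 1ℤ 1≉0

      -- The number of points does not depend on d. This links the conic with d = 2, which governs
      -- m₃, to the circle with d = 1, from which the sign of σ₁₂ is read.
      c≡c′ : c ≡ c′
      c≡c′ = double-injective c c′ (ℕ.suc-injective (trans (sym h≡) h≡′))

      sgn-σ₁₂-arcs : sgn (inducedGen p σ₁₂) ≡ parity b
      sgn-σ₁₂-arcs = trans (sgn-σ₁₂ nonSquare) swapCycles-parity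

      e≡0 : ∀ e → e ℕ.≤ 1 → parity e ≡ 0ℙ → e ≡ 0
      e≡0 0 _ _ = refl
      e≡0 (suc (suc _)) (s≤s ()) _

      c≡b+b : parity c ≡ 0ℙ → c ≡ b ℕ.+ b
      c≡b+b ev = trans c≡c′ (trans count (cong (b ℕ.+_) (trans (cong (b ℕ.+_)
        (e≡0 e diagonal-≤1 (trans (sym (Circle.parity-card circle diagonal)) (trans (cong parity (sym c≡c′)) ev)))) (ℕ.+-identityʳ b))))
        where count = Circle.count circle arcs diagonal

    to : HinAlt p → p ℕ.% 16 ≡ 3
    -- Evenness of m₃ gives c = 2b and evenness of σ₁₂ gives b = 2j, so h = 1 + 2c = 1 + 8j.
    to H = ⇒%16 p h p≡2h+1 j (trans h≡ (cong (λ n → suc (n ℕ.+ n)) (trans (c≡b+b c-even) (cong (λ n → n ℕ.+ n) b≡j+j))))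
      where
      c-even : parity c ≡ 0ℙ
      c-even = trans (sym sgn-m₃-conic) (HinAlt⇒ H r₃)
      b-even = parity-even b (trans (sym sgn-σ₁₂-arcs) (HinAlt⇒ H s₁₂))
      j = proj₁ b-even
      b≡j+j : b ≡ j ℕ.+ j
      b≡j+j = proj₂ b-even

    from : p ℕ.% 16 ≡ 3 → HinAlt p
    from eq = HinAlt-from (trans sgn-m₃-conic c-even) (trans sgn-σ₁₂-arcs b-even)
      where
      q = proj₁ (%16⇒ p h p≡2h+1 eq)
      c≡4q : c ≡ (q ℕ.+ q) ℕ.+ (q ℕ.+ q)
      c≡4q = double-injective c ((q ℕ.+ q) ℕ.+ (q ℕ.+ q)) (ℕ.suc-injective (trans (sym h≡) (proj₂ (%16⇒ p h p≡2h+1 eq))))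
      c-even : parity c ≡ 0ℙ
      c-even = trans (cong parity c≡4q) (parity-double (q ℕ.+ q))
      b-even : parity b ≡ 0ℙ
      b-even = trans (cong parity (double-injective b (q ℕ.+ q) (trans (sym (c≡b+b c-even)) c≡4q))) (parity-double q)

  -- The case distinction is decided by a finite search; the classes up to sign suffice, since `a`
  -- and `∣ a ∣ₚ` have the same square.
  minusOne? : (∃ λ i → i * i ≈ - 1ℤ) ⊎ MinusOneNonSquare
  minusOne? = search (halves ∩ (λ t → (+ t * + t) ≈? (- 1ℤ)))
    where
    search : Enum (λ t → Half t × + t * + t ≈ - 1ℤ) → (∃ λ i → i * i ≈ - 1ℤ) ⊎ MinusOneNonSquare
    search (enum (t ∷ _) _ snd _) = inj₁ (+ t , proj₂ (snd (here refl)))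
    search (enum [] _ _ cmp) = inj₂ λ a q → case cmp {∣ a ∣ₚ} (∣∣ₚ-half a (a≉0 a q) , ≈-trans (∣∣ₚ-sq a) q) of λ ()
      where
      a≉0 : ∀ a → a * a ≈ - 1ℤ → a ≉ 0ℤ
      a≉0 a q r = 1≉0 (by₂ 1ℤ (- a) q r (solve (a ∷ [])))

  theorem : HinAlt p ⇔ p ℕ.% 16 ≡ 3
  theorem = [ (λ (i , q) → mk⇔ (SquareCase.to i q) (SquareCase.from i q)) ,
              (λ ns → mk⇔ (NonSquareCase.to ns) (NonSquareCase.from ns)) ]′ minusOne?

theorem1p2 : (p : ℕ) .{{_ : NonZero p}} → Prime p → 3 < p →
    (HinAlt p ⇔ p % 16 ≡ 3)
theorem1p2 p pr 3<p = OddPrime.theorem p pr (p ℕ./ 2) (odd-prime p pr 2<p) 2<p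
  where
  2<p : 2 < p
  2<p = ℕ.<-trans (ℕ.n<1+n 2) 3<p
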